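{- Let $\ell$ be an irrecoverable positive definite binary $\mathbb{Z}$-lattice with $\mathfrak{n}\ell=s\mathbb{Z}$ ($s$ a positive integer) and $D_\ell=s^2D$, and let $L$ be an isolation of $\ell$. Then for every prime $p$ such that $\left(\frac{D}{p}\right)=1$ and $p\in Q(\mathcal{D})$ for some ambiguous class $\mathcal{D}\in\mathfrak{S}_D$, the lattice $L$ has a primitive binary sublattice $M$ with $\mathfrak{n}M\subseteq p\mathbb{Z}$.
   Context: A $\mathbb{Z}$-lattice is a free $\mathbb{Z}$-module with a positive definite symmetric bilinear form $B$ (rational values), $Q(x)=B(x,x)$; $\mathfrak{s}L$ (scale) and $\mathfrak{n}L$ (norm) are the $\mathbb{Z}$-modules generated by $\{B(x,y)\}$ and $\{Q(x)\}$ respectively. For a binary lattice with Gram matrix $\begin{pmatrix} a & b/2\\ b/2 & c\end{pmatrix}$, $D_\ell=b^2-4ac$. A lattice $K$ is represented by $L$ if there is a $\mathbb{Z}$-linear map $\sigma:K\to L$ with $B(\sigma x,\sigma y)=B(x,y)$. A proper sublattice of $\ell$ is a sublattice of the same rank and index $>1$. An isolation of $\ell$ is a $\mathbb{Z}$-lattice $L$ with $\mathfrak{s}L\subseteq\mathbb{Z}$ which represents every proper sublattice of $\ell$ but does not represent $\ell$; $\ell$ is irrecoverable if it has an isolation. A sublattice $M\subseteq L$ is primitive if $M=\mathbb{Q}M\cap L$. $\mathfrak{S}_D$ is the form class group of proper equivalence classes of positive definite forms $ax^2+bxy+cy^2$ with $\gcd(a,b,c)=1$, $b^2-4ac=D$,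 under Gauss composition with identity $\mathcal{E}$; a class $\mathcal{D}$ is ambiguous if $\mathcal{D}^2=\mathcal{E}$; $Q(\mathcal{D})$ is the set of integers represented by forms in $\mathcal{D}$. $\left(\frac{D}{p}\right)$ is the Kronecker symbol. -}

module Defs where

open import Data.Nat using (ℕ; zero; suc)
open import Data.Nat.Primality using (Prime)
open import Data.Integer using (ℤ; +_; _+_; _*_; _-_; -_; _<_; ∣_∣)
open import Data.Integer.Divisibility using (_∣_)
open import Data.Integer.GCD using (gcd)
open import Data.Fin using (Fin; zero; suc)
open import Data.List using (List; []; _∷_; foldr)
open import Data.Product using (Σ; _×_; _,_; ∃; ∃-syntax)
open import Data.Sum using (_⊎_)
open import Relation.Nullary using (¬_)
open import Relation.Binary.PropositionalEquality using (_≡_; _≢_)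

Vect : ℕ → Set
Vect n = Fin n → ℤ

Mat : ℕ → ℕ → Set
Mat m n = Fin m → Fin n → ℤ

Σᶠ : ∀ {n} → (Fin n → ℤ) → ℤ
Σᶠ {zero}  f = + 0
Σᶠ {suc n} f = f zero + Σᶠ (λ i → f (suc i))

_·ᵥ_ : ∀ {m n} → Mat m n → Vect n → Vect m
(T ·ᵥ y) i = Σᶠ (λ k → T i k * y k)

NonZeroV : ∀ {n} → Vect n → Set
NonZeroV {n} x = ∃[ i ] (x i ≢ + 0)

bil : ∀ {n} → Mat n n → Vect n → Vect n → ℤ
bil G x y = Σᶠ (λ i → Σᶠ (λ j → x i * G i j * y j))

det2 : Mat 2 2 → ℤ
det2 U = U zero zero * U (suc zero) (suc zero) - U zero (suc zero) * U (suc zero) zero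

-- Z-lattices L with 𝔰L ⊆ ℤ: ℤ^n with an integral symmetric positive
-- definite Gram matrix (B(x,y) = x^T G y).

record IntLattice (n : ℕ) : Set where
  field
    gram   : Mat n n
    symm   : ∀ i j → gram i j ≡ gram j i
    posdef : ∀ (x : Vect n) → NonZeroV x → + 0 < bil gram x x

open IntLattice public

B : ∀ {n} → IntLattice n → Vect n → Vect n → ℤ
B L = bil (gram L)

Qf : ∀ {n} → IntLattice n → Vect n → ℤ
Qf L x = B L x x

-- Binary lattice ℓ with Gram matrix (a , b/2 ; b/2 , c), a b c ∈ ℤ.
-- We store the integral matrix 2·Gram = (2a , b ; b , 2c).

record BinForm : Set where
  constructor form
  field
    fa fb fc : ℤ

open BinForm public

gram2 : BinForm → Mat 2 2
gram2 f zero       zero       = + 2 * fa f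
gram2 f zero       (suc zero) = fb f
gram2 f (suc zero) zero       = fb f
gram2 f (suc zero) (suc zero) = + 2 * fc f

twoBℓ : BinForm → Vect 2 → Vect 2 → ℤ
twoBℓ f = bil (gram2 f)

evalF : BinForm → ℤ → ℤ → ℤ
evalF f x y = fa f * x * x + fb f * x * y + fc f * y * y

Qℓ : BinForm → Vect 2 → ℤ
Qℓ f v = evalF f (v zero) (v (suc zero))

discF : BinForm → ℤ
discF f = fb f * fb f - + 4 * fa f * fc f

PosDefLattice : BinForm → Set
PosDefLattice f = ∀ (x : Vect 2) → NonZeroV x → + 0 < Qℓ f x

-- 𝔫ℓ = sℤ : the ℤ-module generated by {Q(x)} equals sℤ
-- (every generator lies in sℤ, and s is a ℤ-combination of generators)
LinComb : BinForm → List (ℤ × Vect 2) → ℤ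
LinComb f = foldr (λ { (k , v) acc → k * Qℓ f v + acc }) (+ 0)

NormIs : BinForm → ℤ → Set
NormIs f s = (∀ (v : Vect 2) → s ∣ Qℓ f v) × (∃[ cs ] (LinComb f cs ≡ s))

-- Representations.
-- A ℤ-linear map ℤ² → ℤⁿ is an n×2 integer matrix T.
-- The sublattice U ℤ² of ℓ (U a 2×2 integer matrix) is represented by L
-- iff some T satisfies B_L(Ty,Tz) = B_ℓ(Uy,Uz) for all y z
-- (stated after multiplying both sides by 2).

RepresentsSub : ∀ {n} → IntLattice n → BinForm → Mat 2 2 → Set
RepresentsSub {n} L f U =
  ∃[ T ] (∀ (y z : Vect 2) →
    + 2 * B L ((_·ᵥ_ {n} {2} T) y) ((_·ᵥ_ {n} {2} T) z)
      ≡ twoBℓ f (U ·ᵥ y) (U ·ᵥ z))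

Represents : ∀ {n} → IntLattice n → BinForm → Set
Represents {n} L f =
  ∃[ T ] (∀ (y z : Vect 2) →
    + 2 * B L ((_·ᵥ_ {n} {2} T) y) ((_·ᵥ_ {n} {2} T) z) ≡ twoBℓ f y z)

-- Proper sublattices of ℓ: U ℤ² with U nonsingular and index |det U| > 1.
IsIsolation : ∀ {n} → BinForm → IntLattice n → Set
IsIsolation f L =
  (∀ (U : Mat 2 2) → + 1 < + ∣ det2 U ∣ → RepresentsSub L f U)
  × ¬ Represents L f

Irrecoverable : BinForm → Set
Irrecoverable f = ∃[ n ] Σ (IntLattice n) (IsIsolation f)

-- Primitive binary sublattice M = T ℤ² of L with 𝔫M ⊆ pℤ

Rank2 : ∀ {n} → Mat n 2 → Set
Rank2 T = ∀ (y : Vect 2) → (∀ i → (T ·ᵥ y) i ≡ + 0) → ∀ k → y k ≡ + 0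

-- M = ℚM ∩ L : if k x ∈ M with k ≠ 0 then x ∈ M
Primitive : ∀ {n} → Mat n 2 → Set
Primitive {n} T = ∀ (x : Vect n) (k : ℤ) → k ≢ + 0 →
  (∃[ y ] (∀ i → k * x i ≡ (T ·ᵥ y) i)) →
  ∃[ z ] (∀ i → x i ≡ (T ·ᵥ z) i)

NormDividedBy : ∀ {n} → IntLattice n → Mat n 2 → ℤ → Set
NormDividedBy {n} L T m = ∀ (y : Vect 2) → m ∣ Qf L ((_·ᵥ_ {n} {2} T) y)

Cong : ℤ → ℤ → ℤ → Set
Cong m x y = m ∣ (x - y)

KroneckerOne : ℤ → ℕ → Set
KroneckerOne D p =
  (p ≡ 2 × (Cong (+ 8) D (+ 1) ⊎ Cong (+ 8) D (- + 1)))
  ⊎ (p ≢ 2 × ¬ (+ p ∣ D) × ∃[ x ] (Cong (+ p) (x * x) D))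

InFormGroup : ℤ → BinForm → Set
InFormGroup D f = discF f ≡ D × + 0 < fa f × gcd (gcd (fa f) (fb f)) (fc f) ≡ + 1

ProperlyEquiv : BinForm → BinForm → Set
ProperlyEquiv f g = ∃[ α ] ∃[ β ] ∃[ γ ] ∃[ δ ]
  ((α * δ - β * γ ≡ + 1) ×
   (∀ x y → evalF f (α * x + β * y) (γ * x + δ * y) ≡ evalF g x y))

InPrincipalClass : ℤ → BinForm → Set
InPrincipalClass D F = ∃[ b₀ ] ∃[ c₀ ]
  ((b₀ ≡ + 0 ⊎ b₀ ≡ + 1) × (b₀ * b₀ - + 4 * c₀ ≡ D) × ProperlyEquiv F (form (+ 1) b₀ c₀))

-- Gauss composition (direct composition, Cox (3.5)-(3.6)):
-- f(x,y) g(z,w) = F(B₁,B₂), Bᵢ = aᵢxz + bᵢxw + cᵢyz + dᵢyw,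
-- with a₁b₂ - a₂b₁ = a_f and a₁c₂ - a₂c₁ = a_g.
DirectComposite : BinForm → BinForm → BinForm → Set
DirectComposite f g F = ∃[ a₁ ] ∃[ b₁ ] ∃[ c₁ ] ∃[ d₁ ] ∃[ a₂ ] ∃[ b₂ ] ∃[ c₂ ] ∃[ d₂ ]
  ((a₁ * b₂ - a₂ * b₁ ≡ fa f) × (a₁ * c₂ - a₂ * c₁ ≡ fa g) ×
   (∀ x y z w → evalF f x y * evalF g z w ≡
      evalF F (a₁ * x * z + b₁ * x * w + c₁ * y * z + d₁ * y * w)
              (a₂ * x * z + b₂ * x * w + c₂ * y * z + d₂ * y * w)))

AmbiguousClass : ℤ → BinForm → Set
AmbiguousClass D f = ∃[ F ] (InFormGroup D F × DirectComposite f f F × InPrincipalClass D F)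

-- p ∈ Q(𝒟) for some ambiguous class 𝒟 ∈ 𝔖_D
-- (𝒟 = [f]; Q(𝒟) = integers represented by f, since equivalent forms
-- represent the same integers; we take f itself as the representative)
RepresentedByAmbiguous : ℤ → ℤ → Set
RepresentedByAmbiguous D m = ∃[ f ] (InFormGroup D f × AmbiguousClass D f ×
  ∃[ x ] ∃[ y ] (evalF f x y ≡ m))

{-# OPTIONS --safe #-}

-- Write ℓ = s g with g primitive of discriminant D.  Represent a sublattice of index p of ℓ in L,
-- saturate its image to a primitive M, and let φ be the form of M, so that φ ∘ N = ℓ ∘ U with
-- U = diag(1,p).  Suppose p does not divide the norm of M.  Substituting adj(N) z gives
-- ℓ(U adj(N) z) = det(N)² φ(z), so the p-adic valuation of the left-hand side is even for some z.
--
-- If ord_p(s) is odd, choose the sublattice along a line on which g is nonzero mod p: parity forces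
-- N to be divisible by U on the right, and φ represents ℓ.  If ord_p(s) is even, choose it along an
-- isotropic line of g mod p, so that g ∘ U = p h: parity forces adj(N) mod p into one of the two
-- isotropic lines of h.  One of them again yields ℓ.  The other one does so because the prime ideal
-- P over p has an ambiguous class: P² is generated by an element of norm p² not divisible by p, and
-- multiplication by it is a similitude of g exchanging the roles of the two lines.
-- In both cases L represents ℓ, which is absurd.
module Submission where

open import Defs
open import Data.Nat using (ℕ; zero; suc)
import Data.Nat as ℕ
import Data.Nat.Properties as ℕₚ
import Data.Nat.Divisibility as ℕᵈ
open import Data.Nat.GCD using (module Bézout; module GCD)
open import Data.Nat.Primality using (Prime; prime[2]; euclidsLemma; prime⇒nonZero; prime⇒nonTrivial)
open import Data.Integer using (ℤ; +_; _+_; _*_; _-_; -_; _<_; ≢-nonZero; +<+) renaming (∣_∣ to abs)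
open import Data.Integer.Properties
open import Data.Integer.Divisibility.Signed
import Data.Integer.Divisibility as ℤᵘ
open import Data.Integer.Tactic.RingSolver using (solve-∀)
open import Data.Fin using (Fin; zero; suc)
open import Data.List using ([]; _∷_)
open import Data.Product using (Σ; _×_; _,_; proj₁; proj₂; ∃-syntax)
open import Data.Sum using (_⊎_; inj₁; inj₂; [_,_]′)
open import Data.Empty using (⊥-elim)
open import Relation.Nullary using (¬_; yes; no)
open import Relation.Binary.PropositionalEquality using (_≡_; _≢_; refl; sym; trans; cong; cong₂; subst; module ≡-Reasoning)

open ≡-Reasoning

-- Integer arithmetic

*-cancelˡ : ∀ k {i j} → k ≢ + 0 → k * i ≡ k * j → i ≡ j
*-cancelˡ k {i} {j} k≢0 = *-cancelˡ-≡ k i j {{≢-nonZero k≢0}}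

*-≡0⇒ʳ : ∀ k {i} → k ≢ + 0 → k * i ≡ + 0 → i ≡ + 0
*-≡0⇒ʳ k k≢0 eq = *-cancelˡ k k≢0 (trans eq (sym (*-zeroʳ k)))

*-≢0 : ∀ i j → i ≢ + 0 → j ≢ + 0 → i * j ≢ + 0
*-≢0 i j i≢0 j≢0 eq = j≢0 (*-≡0⇒ʳ i i≢0 eq)

-- Certificate for an equation that follows from a hypothesis: once the cofactor `c` is supplied,
-- only a polynomial identity is left for the ring solver.
≡-comb₁ : ∀ {x y l r} c → l ≡ r → x - y ≡ c * (l - r) → x ≡ y
≡-comb₁ {x} {y} {l} c refl eq = i-j≡0⇒i≡j x y (trans eq (ring c l))
  where
  ring : ∀ c l → c * (l - l) ≡ + 0
  ring = solve-∀

≡-comb₂ : ∀ {x y l r l′ r′} c c′ → l ≡ r → l′ ≡ r′ → x - y ≡ c * (l - r) + c′ * (l′ - r′) → x ≡ y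
≡-comb₂ {x} {y} {l} {l′ = l′} c c′ refl refl eq = i-j≡0⇒i≡j x y (trans eq (ring c l c′ l′))
  where
  ring : ∀ c l c′ l′ → c * (l - l) + c′ * (l′ - l′) ≡ + 0
  ring = solve-∀

-- The same scheme for divisibility, again with cofactors supplied by the caller.
∣-comb₁ : ∀ {k x y} c → k ∣ y → x ≡ c * y → k ∣ x
∣-comb₁ {k} c k∣y eq = subst (k ∣_) (sym eq) (∣n⇒∣m*n c k∣y)

∣-comb₂ : ∀ {k x y z} c d → k ∣ y → k ∣ z → x ≡ c * y + d * z → k ∣ x
∣-comb₂ {k} c d k∣y k∣z eq = subst (k ∣_) (sym eq) (∣m∣n⇒∣m+n (∣n⇒∣m*n c k∣y) (∣n⇒∣m*n d k∣z))

∣-comb₃ : ∀ {k x y z w} c d e → k ∣ y → k ∣ z → k ∣ w → x ≡ c * y + d * z + e * w → k ∣ x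
∣-comb₃ {k} c d e k∣y k∣z k∣w eq =
  subst (k ∣_) (sym eq) (∣m∣n⇒∣m+n (∣m∣n⇒∣m+n (∣n⇒∣m*n c k∣y) (∣n⇒∣m*n d k∣z)) (∣n⇒∣m*n e k∣w))

-- The identity for natural numbers is carried over to the integers by cofactors `σ`, `τ` with |a| =
-- `σ` a and |b| = `τ` b.
bézout : ∀ a b → ∃[ g ] ∃[ a′ ] ∃[ b′ ] ∃[ x ] ∃[ y ] (a ≡ a′ * g × b ≡ b′ * g × x * a + y * b ≡ g)
bézout a b with Bézout.lemma (abs a) (abs b)
... | Bézout.result d gcd identity with ∣ᵤ⇒∣ {+ d} {a} (proj₁ (GCD.commonDivisor gcd))
                                      | ∣ᵤ⇒∣ {+ d} {b} (proj₂ (GCD.commonDivisor gcd))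
                                      | m∣∣m∣ {a} | m∣∣m∣ {b}
...   | divides a′ ea | divides b′ eb | divides σ eσ | divides τ eτ = + d , a′ , b′ , combination identity
  where
  combination : Bézout.Identity d (abs a) (abs b) → ∃[ x ] ∃[ y ] (a ≡ a′ * + d × b ≡ b′ * + d × x * a + y * b ≡ + d)
  combination (Bézout.+- x y eq) = + x * σ , - (+ y * τ) , ea , eb , (begin
    + x * σ * a + - (+ y * τ) * b     ≡⟨ regroup (+ x) σ a (+ y) τ b ⟩
    + x * (σ * a) - + y * (τ * b)     ≡⟨ cong₂ (λ i j → + x * i - + y * j) (sym eσ) (sym eτ) ⟩
    + x * + (abs a) - + y * + (abs b)     ≡⟨ cong₂ _-_ (sym (pos-* x (abs a))) (sym (pos-* y (abs b))) ⟩
    + (x ℕ.* abs a) - + (y ℕ.* abs b) ≡⟨ cong (λ i → + i - + (y ℕ.* abs b)) (sym eq) ⟩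
    + d + + (y ℕ.* abs b) - + (y ℕ.* abs b) ≡⟨ cancel (+ d) (+ (y ℕ.* abs b)) ⟩
    + d ∎)
    where
    regroup : ∀ x σ a y τ b → x * σ * a + - (y * τ) * b ≡ x * (σ * a) - y * (τ * b)
    regroup = solve-∀
    cancel : ∀ i j → i + j - j ≡ i
    cancel = solve-∀
  combination (Bézout.-+ x y eq) = - (+ x * σ) , + y * τ , ea , eb , (begin
    - (+ x * σ) * a + + y * τ * b     ≡⟨ regroup (+ x) σ a (+ y) τ b ⟩
    + y * (τ * b) - + x * (σ * a)     ≡⟨ cong₂ (λ i j → + y * j - + x * i) (sym eσ) (sym eτ) ⟩
    + y * + (abs b) - + x * + (abs a)     ≡⟨ cong₂ _-_ (sym (pos-* y (abs b))) (sym (pos-* x (abs a))) ⟩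
    + (y ℕ.* abs b) - + (x ℕ.* abs a) ≡⟨ cong (λ i → + i - + (x ℕ.* abs a)) (sym eq) ⟩
    + d + + (x ℕ.* abs a) - + (x ℕ.* abs a) ≡⟨ cancel (+ d) (+ (x ℕ.* abs a)) ⟩
    + d ∎)
    where
    regroup : ∀ x σ a y τ b → - (x * σ) * a + y * τ * b ≡ y * (τ * b) - x * (σ * a)
    regroup = solve-∀
    cancel : ∀ i j → i + j - j ≡ i
    cancel = solve-∀

-- Divisibility by a prime and parity of valuations

module PrimeDivisor {p : ℕ} (pr : Prime p) where

  π : ℤ
  π = + p

  π≢0 : π ≢ + 0
  π≢0 π≡0 = ℕ.≢-nonZero⁻¹ p {{prime⇒nonZero pr}} (+-injective π≡0)

  1<p : 1 ℕ.< p
  1<p = ℕ.nonTrivial⇒n>1 p {{prime⇒nonTrivial pr}}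

  π∤1 : ¬ π ∣ + 1
  π∤1 π∣1 = ℕₚ.<⇒≢ 1<p (sym (ℕᵈ.∣1⇒≡1 (∣⇒∣ᵤ π∣1)))

  euclid : ∀ i j → π ∣ i * j → π ∣ i ⊎ π ∣ j
  euclid i j π∣ij with euclidsLemma (abs i) (abs j) pr (subst (p ℕᵈ.∣_) (abs-* i j) (∣⇒∣ᵤ π∣ij))
  ... | inj₁ q = inj₁ (∣ᵤ⇒∣ q)
  ... | inj₂ q = inj₂ (∣ᵤ⇒∣ q)

  euclidʳ : ∀ {i j} → ¬ π ∣ i → π ∣ i * j → π ∣ j
  euclidʳ {i} {j} ¬i π∣ij = [ (λ q → ⊥-elim (¬i q)) , (λ q → q) ]′ (euclid i j π∣ij)

  euclid² : ∀ {i} → π ∣ i * i → π ∣ i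
  euclid² {i} π∣ii = [ (λ q → q) , (λ q → q) ]′ (euclid i i π∣ii)

  -- The gcd `g` of `i` and `π` divides `π`. If `π` divided `g` it would divide `i`; so `g` is a
  -- unit, and the Bézout coefficient of `i` is an inverse up to that unit.
  invert : ∀ {i} → ¬ π ∣ i → ∃[ y ] (π ∣ y * i - + 1)
  invert {i} ¬i with bézout i π
  ... | g , i′ , π′ , x , y , ei , eπ , e with euclid π′ g (subst (π ∣_) eπ ∣-refl)
  ...   | inj₂ π∣g = ⊥-elim (¬i (∣-comb₁ i′ π∣g ei))
  ...   | inj₁ (divides q refl) = x * q , divides (- (q * y)) (≡-comb₂ q (+ 1) e g≡1 (ring x q i y π g))
    where
    regroup : ∀ q π g → π * (q * g) ≡ q * π * g
    regroup = solve-∀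
    g≡1 : q * g ≡ + 1
    g≡1 = *-cancelˡ π π≢0 (trans (regroup q π g) (trans (sym eπ) (sym (*-identityʳ π))))
    ring : ∀ x q i y π g → (x * q * i - + 1) - (- (q * y) * π) ≡ q * ((x * i + y * π) - g) + + 1 * (q * g - + 1)
    ring = solve-∀

  -- Nonzero integers of even valuation at `π`, generated from the units modulo `π` so that descent
  -- arguments can recurse on the derivation.
  data EvenVal : ℤ → Set where
    unit : ∀ {t} → ¬ π ∣ t → EvenVal t
    step : ∀ {t} → EvenVal t → EvenVal (π * π * t)

  -- Each division by `π` flips the parity and lowers the absolute value, which the first argument
  -- of `bounded` bounds.
  parity : ∀ s → s ≢ + 0 → EvenVal s ⊎ ∃[ t ] (EvenVal t × s ≡ t * π)
  parity s = bounded (abs s) s ℕₚ.≤-refl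
    where
    bounded : ∀ m s → abs s ℕ.≤ m → s ≢ + 0 → EvenVal s ⊎ ∃[ t ] (EvenVal t × s ≡ t * π)
    bounded zero s le s≢0 = ⊥-elim (s≢0 (∣i∣≡0⇒i≡0 (ℕₚ.n≤0⇒n≡0 le)))
    bounded (suc m) s le s≢0 with π ∣? s
    ... | no  π∤s = inj₁ (unit π∤s)
    ... | yes (divides t refl) with bounded m t smaller t≢0
      where
      t≢0 : t ≢ + 0
      t≢0 refl = s≢0 refl
      smaller : abs t ℕ.≤ m
      smaller = ℕₚ.≤-pred (ℕₚ.≤-trans
        (subst (abs t ℕ.<_) (sym (abs-* t π))
          (ℕₚ.m<m*n (abs t) p {{ℕ.≢-nonZero (λ e → t≢0 (∣i∣≡0⇒i≡0 e))}} 1<p)) le)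
    ...   | inj₁ et = inj₂ (t , et , refl)
    ...   | inj₂ (r , er , refl) = inj₁ (subst EvenVal (ring r π) (step er))
      where
      ring : ∀ r π → π * π * r ≡ r * π * π
      ring = solve-∀

  -- The right-hand side has even valuation wherever φ is a unit, the factor s * π odd valuation.
  odd-valuation : (H φ : ℤ → ℤ → ℤ) → ∀ {s} → EvenVal s → ∀ d →
    (∀ x y → s * π * H x y ≡ d * d * φ x y) → ∀ x₀ y₀ → ¬ π ∣ φ x₀ y₀ → ∀ x y → π ∣ H x y
  odd-valuation H φ {s} es d eq x₀ y₀ ¬φ = go es d eq
    where
    -- At (`x₀`, `y₀`) the form `φ` is a unit modulo `π`, so the factor `π` on the left must come
    -- from d².
    π∣d : ∀ {s} d → (∀ x y → s * π * H x y ≡ d * d * φ x y) → π ∣ d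
    π∣d {s} d eq with euclid (d * d) (φ x₀ y₀) (divides (s * H x₀ y₀) (trans (sym (eq x₀ y₀)) (ring s π (H x₀ y₀))))
      where
      ring : ∀ s π h → s * π * h ≡ s * h * π
      ring = solve-∀
    ... | inj₁ q = euclid² q
    ... | inj₂ q = ⊥-elim (¬φ q)
    go : ∀ {s} → EvenVal s → ∀ d → (∀ x y → s * π * H x y ≡ d * d * φ x y) → ∀ x y → π ∣ H x y
    -- With d = d′ π, cancelling one `π` leaves a surplus `π` on the right, which divides `H`
    -- because `s` is a unit. In the `step` case π² cancels from both sides and d′ replaces d.
    go {s} (unit π∤s) d eq x y with π∣d {s} d eq
    ... | divides d′ refl = euclidʳ π∤s (divides (d′ * d′ * φ x y) (*-cancelˡ π π≢0
            (trans (left s π (H x y)) (trans (eq x y) (right d′ π (φ x y))))))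
      where
      left : ∀ s π h → π * (s * h) ≡ s * π * h
      left = solve-∀
      right : ∀ d π φ → d * π * (d * π) * φ ≡ π * (d * d * φ * π)
      right = solve-∀
    go (step {t} et) d eq with π∣d {π * π * t} d eq
    ... | divides d′ refl = go et d′ λ x y → *-cancelˡ (π * π) (*-≢0 π π π≢0 π≢0)
            (trans (left t π (H x y)) (trans (eq x y) (right d′ π (φ x y))))
      where
      left : ∀ t π h → π * π * (t * π * h) ≡ π * π * t * π * h
      left = solve-∀
      right : ∀ d π φ → d * π * (d * π) * φ ≡ π * π * (d * d * φ)
      right = solve-∀

  -- Two linear forms, given by their values at (1,0) and (0,1), have a product vanishing modulo `π`
  -- at three distinct points of the projective line. By pigeonhole one form has two zeros there, so
  -- it vanishes identically.
  same-factor : ∀ i₁ i₂ j₁ j₂ → π ∣ i₁ * j₁ → π ∣ i₂ * j₂ → π ∣ (i₁ + i₂) * (j₁ + j₂) →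
    (π ∣ i₁ × π ∣ i₂) ⊎ (π ∣ j₁ × π ∣ j₂)
  same-factor i₁ i₂ j₁ j₂ h₁ h₂ h₃ with euclid i₁ j₁ h₁ | euclid i₂ j₂ h₂ | euclid (i₁ + i₂) (j₁ + j₂) h₃
  ... | inj₁ a | inj₁ b | _      = inj₁ (a , b)
  ... | inj₂ a | inj₂ b | _      = inj₂ (a , b)
  ... | inj₁ a | inj₂ b | inj₁ c = inj₁ (a , ∣m+n∣m⇒∣n c a)
  ... | inj₁ a | inj₂ b | inj₂ c = inj₂ (∣m+n∣n⇒∣m c b , b)
  ... | inj₂ a | inj₁ b | inj₁ c = inj₁ (∣m+n∣n⇒∣m c b , b)
  ... | inj₂ a | inj₁ b | inj₂ c = inj₂ (a , ∣m+n∣m⇒∣n c a)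

-- Binary forms under integral substitutions

-- A record instead of a function on indices, so that equality of the entries yields equality of
-- matrices.
record Mat₂ : Set where
  constructor mat
  field
    m₁₁ m₁₂ m₂₁ m₂₂ : ℤ

open Mat₂

infixl 7 _∙_ _∘ᶠ_
infixr 8 _·ᶠ_

_∙_ : Mat₂ → Mat₂ → Mat₂
mat a b c d ∙ mat a′ b′ c′ d′ = mat (a * a′ + b * c′) (a * b′ + b * d′) (c * a′ + d * c′) (c * b′ + d * d′)

scalar : ℤ → Mat₂
scalar k = mat k (+ 0) (+ 0) k

diag : ℤ → ℤ → Mat₂
diag k l = mat k (+ 0) (+ 0) l

det : Mat₂ → ℤ
det (mat a b c d) = a * d - b * c

_∘ᶠ_ : BinForm → Mat₂ → BinForm
form a b c ∘ᶠ mat α β γ δ = form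
  (a * α * α + b * α * γ + c * γ * γ)
  (+ 2 * a * α * β + b * (α * δ + β * γ) + + 2 * c * γ * δ)
  (a * β * β + b * β * δ + c * δ * δ)

_·ᶠ_ : ℤ → BinForm → BinForm
k ·ᶠ form a b c = form (k * a) (k * b) (k * c)

form-≡ : ∀ {a b c a′ b′ c′} → a ≡ a′ → b ≡ b′ → c ≡ c′ → form a b c ≡ form a′ b′ c′
form-≡ refl refl refl = refl

mat-≡ : ∀ {a b c d a′ b′ c′ d′} → a ≡ a′ → b ≡ b′ → c ≡ c′ → d ≡ d′ → mat a b c d ≡ mat a′ b′ c′ d′
mat-≡ refl refl refl refl = refl

evalF-∘ : ∀ f M x y → evalF (f ∘ᶠ M) x y ≡ evalF f (m₁₁ M * x + m₁₂ M * y) (m₂₁ M * x + m₂₂ M * y)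
evalF-∘ (form a b c) (mat α β γ δ) x y = ring a b c α β γ δ x y
  where
  ring : ∀ a b c α β γ δ x y →
    (a * α * α + b * α * γ + c * γ * γ) * x * x
    + (+ 2 * a * α * β + b * (α * δ + β * γ) + + 2 * c * γ * δ) * x * y
    + (a * β * β + b * β * δ + c * δ * δ) * y * y
    ≡ a * (α * x + β * y) * (α * x + β * y) + b * (α * x + β * y) * (γ * x + δ * y)
    + c * (γ * x + δ * y) * (γ * x + δ * y)
  ring = solve-∀

evalF-· : ∀ k f x y → evalF (k ·ᶠ f) x y ≡ k * evalF f x y
evalF-· k (form a b c) x y = ring k a b c x y
  where
  ring : ∀ k a b c x y → k * a * x * x + k * b * x * y + k * c * y * y ≡ k * (a * x * x + b * x * y + c * y * y)
  ring = solve-∀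

evalF-scale : ∀ f k x y → evalF f (k * x) (k * y) ≡ k * k * evalF f x y
evalF-scale (form a b c) k x y = ring a b c k x y
  where
  ring : ∀ a b c k x y → a * (k * x) * (k * x) + b * (k * x) * (k * y) + c * (k * y) * (k * y)
    ≡ k * k * (a * x * x + b * x * y + c * y * y)
  ring = solve-∀

-- The values at (1,0), (0,1) and (1,1) recover the coefficients. Identities between forms can thus
-- be proved by comparing values.
evalF-injective : ∀ f g → (∀ x y → evalF f x y ≡ evalF g x y) → f ≡ g
evalF-injective (form a b c) (form a′ b′ c′) eq = form-≡ a≡ b≡ c≡
  where
  at10 : ∀ a b c → a * + 1 * + 1 + b * + 1 * + 0 + c * + 0 * + 0 ≡ a
  at10 = solve-∀
  at01 : ∀ a b c → a * + 0 * + 0 + b * + 0 * + 1 + c * + 1 * + 1 ≡ c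
  at01 = solve-∀
  at11 : ∀ a b c → a * + 1 * + 1 + b * + 1 * + 1 + c * + 1 * + 1 - a - c ≡ b
  at11 = solve-∀
  a≡ : a ≡ a′
  a≡ = trans (sym (at10 a b c)) (trans (eq (+ 1) (+ 0)) (at10 a′ b′ c′))
  c≡ : c ≡ c′
  c≡ = trans (sym (at01 a b c)) (trans (eq (+ 0) (+ 1)) (at01 a′ b′ c′))
  b≡ : b ≡ b′
  b≡ = trans (sym (at11 a b c)) (trans (cong₂ _-_ (cong₂ _-_ (eq (+ 1) (+ 1)) a≡) c≡) (at11 a′ b′ c′))

∘ᶠ-∙ : ∀ f M N → f ∘ᶠ M ∘ᶠ N ≡ f ∘ᶠ (M ∙ N)
∘ᶠ-∙ f M N = evalF-injective _ _ λ x y → begin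
  evalF (f ∘ᶠ M ∘ᶠ N) x y ≡⟨ evalF-∘ (f ∘ᶠ M) N x y ⟩
  evalF (f ∘ᶠ M) (m₁₁ N * x + m₁₂ N * y) (m₂₁ N * x + m₂₂ N * y)
    ≡⟨ evalF-∘ f M _ _ ⟩
  evalF f (m₁₁ M * (m₁₁ N * x + m₁₂ N * y) + m₁₂ M * (m₂₁ N * x + m₂₂ N * y))
          (m₂₁ M * (m₁₁ N * x + m₁₂ N * y) + m₂₂ M * (m₂₁ N * x + m₂₂ N * y))
    ≡⟨ cong₂ (evalF f) (ring (m₁₁ M) (m₁₂ M) (m₁₁ N) (m₁₂ N) (m₂₁ N) (m₂₂ N) x y)
                       (ring (m₂₁ M) (m₂₂ M) (m₁₁ N) (m₁₂ N) (m₂₁ N) (m₂₂ N) x y) ⟩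
  evalF f (m₁₁ (M ∙ N) * x + m₁₂ (M ∙ N) * y) (m₂₁ (M ∙ N) * x + m₂₂ (M ∙ N) * y)
    ≡⟨ evalF-∘ f (M ∙ N) x y ⟨
  evalF (f ∘ᶠ (M ∙ N)) x y ∎
  where
  ring : ∀ a b a′ b′ c′ d′ x y → a * (a′ * x + b′ * y) + b * (c′ * x + d′ * y)
    ≡ (a * a′ + b * c′) * x + (a * b′ + b * d′) * y
  ring = solve-∀

∘ᶠ-scalar : ∀ f k → f ∘ᶠ scalar k ≡ (k * k) ·ᶠ f
∘ᶠ-scalar f k = evalF-injective _ _ λ x y → begin
  evalF (f ∘ᶠ scalar k) x y ≡⟨ evalF-∘ f (scalar k) x y ⟩
  evalF f (k * x + + 0 * y) (+ 0 * x + k * y) ≡⟨ cong₂ (evalF f) (+-identityʳ (k * x)) (+-identityˡ (k * y)) ⟩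
  evalF f (k * x) (k * y) ≡⟨ evalF-scale f k x y ⟩
  k * k * evalF f x y ≡⟨ evalF-· (k * k) f x y ⟨
  evalF ((k * k) ·ᶠ f) x y ∎

·ᶠ-∘ᶠ : ∀ k f M → (k ·ᶠ f) ∘ᶠ M ≡ k ·ᶠ (f ∘ᶠ M)
·ᶠ-∘ᶠ k f M = evalF-injective _ _ λ x y →
  trans (evalF-∘ (k ·ᶠ f) M x y) (trans (evalF-· k f _ _)
    (trans (cong (k *_) (sym (evalF-∘ f M x y))) (sym (evalF-· k (f ∘ᶠ M) x y))))

·ᶠ-cancel : ∀ k → k ≢ + 0 → ∀ f g → k ·ᶠ f ≡ k ·ᶠ g → f ≡ g
·ᶠ-cancel k k≢0 f g eq = evalF-injective f g λ x y → *-cancelˡ k k≢0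
  (trans (sym (evalF-· k f x y)) (trans (cong (λ h → evalF h x y) eq) (evalF-· k g x y)))

discF-∘ : ∀ f M → discF (f ∘ᶠ M) ≡ det M * det M * discF f
discF-∘ (form a b c) (mat α β γ δ) = ring a b c α β γ δ
  where
  ring : ∀ a b c α β γ δ →
    (+ 2 * a * α * β + b * (α * δ + β * γ) + + 2 * c * γ * δ) * (+ 2 * a * α * β + b * (α * δ + β * γ) + + 2 * c * γ * δ)
    - + 4 * (a * α * α + b * α * γ + c * γ * γ) * (a * β * β + b * β * δ + c * δ * δ)
    ≡ (α * δ - β * γ) * (α * δ - β * γ) * (b * b - + 4 * a * c)
  ring = solve-∀

discF-· : ∀ k f → discF (k ·ᶠ f) ≡ k * k * discF f
discF-· k (form a b c) = ring k a b c
  where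
  ring : ∀ k a b c → k * b * (k * b) - + 4 * (k * a) * (k * c) ≡ k * k * (b * b - + 4 * a * c)
  ring = solve-∀

-- Third and second differences of q(t,1)² - k(t,1)² isolate the two lower coefficients.
square-determines : ∀ q k → fa q ≡ fa k → fa k ≢ + 0 →
  (∀ x y → evalF q x y * evalF q x y ≡ evalF k x y * evalF k x y) → q ≡ k
square-determines (form a b′ c′) (form .a b c) refl a≢0 eq = form-≡ refl b≡ c≡
  where
  P : ℤ → ℤ
  P t = evalF (form a b′ c′) t (+ 1) * evalF (form a b′ c′) t (+ 1) - evalF (form a b c) t (+ 1) * evalF (form a b c) t (+ 1)
  P≡0 : ∀ t → P t ≡ + 0
  P≡0 t = i≡j⇒i-j≡0 (eq t (+ 1))
  third : ∀ a b c b′ c′ → let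
      p = λ t → (a * t * t + b′ * t * + 1 + c′ * + 1 * + 1) * (a * t * t + b′ * t * + 1 + c′ * + 1 * + 1)
              - (a * t * t + b * t * + 1 + c * + 1 * + 1) * (a * t * t + b * t * + 1 + c * + 1 * + 1) in
    + 12 * a * (b′ - b) ≡ p (+ 2) - + 3 * p (+ 1) + + 3 * p (+ 0) - p (- + 1)
  third = solve-∀
  second : ∀ a b c c′ → let
      p = λ t → (a * t * t + b * t * + 1 + c′ * + 1 * + 1) * (a * t * t + b * t * + 1 + c′ * + 1 * + 1)
              - (a * t * t + b * t * + 1 + c * + 1 * + 1) * (a * t * t + b * t * + 1 + c * + 1 * + 1) in
    + 4 * a * (c′ - c) ≡ p (+ 1) - + 2 * p (+ 0) + p (- + 1)
  second = solve-∀
  b≡ : b′ ≡ b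
  b≡ = i-j≡0⇒i≡j b′ b (*-≡0⇒ʳ (+ 12 * a) (*-≢0 (+ 12) a (λ ()) a≢0) (trans (third a b c b′ c′) vanish))
    where
    vanish : P (+ 2) - + 3 * P (+ 1) + + 3 * P (+ 0) - P (- + 1) ≡ + 0
    vanish rewrite P≡0 (+ 2) | P≡0 (+ 1) | P≡0 (+ 0) | P≡0 (- + 1) = refl
  -- With b′ = b, the difference of squares is quadratic in t with leading coefficient 2a(c′ - c).
  c≡ : c′ ≡ c
  c≡ = i-j≡0⇒i≡j c′ c (*-≡0⇒ʳ (+ 4 * a) (*-≢0 (+ 4) a (λ ()) a≢0) (trans (second a b c c′) (subst Vanish b≡ vanish)))
    where
    Vanish : ℤ → Set
    Vanish β = let
        p = λ t → evalF (form a β c′) t (+ 1) * evalF (form a β c′) t (+ 1) - evalF (form a b c) t (+ 1) * evalF (form a b c) t (+ 1)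
      in p (+ 1) - + 2 * p (+ 0) + p (- + 1) ≡ + 0
    vanish : Vanish b′
    vanish rewrite P≡0 (+ 1) | P≡0 (+ 0) | P≡0 (- + 1) = refl

-- Gauss composition and ambiguous classes

-- For fixed (x,y) the bilinear map is a substitution `R x y` in (z,w) that turns `F` into k(x,y)
-- times `k`. Comparing discriminants gives det(R)² = k(x,y)², and the prescribed leading
-- coefficient fixes the sign.
composition-minors : ∀ k F a₁ b₁ c₁ d₁ a₂ b₂ c₂ d₂ →
  discF F ≡ discF k → discF k ≢ + 0 → fa k ≢ + 0 → a₁ * b₂ - a₂ * b₁ ≡ fa k →
  (∀ x y z w → evalF k x y * evalF k z w ≡
    evalF F (a₁ * x * z + b₁ * x * w + c₁ * y * z + d₁ * y * w) (a₂ * x * z + b₂ * x * w + c₂ * y * z + d₂ * y * w)) →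
  form (a₁ * b₂ - a₂ * b₁) (a₁ * d₂ + c₁ * b₂ - (b₁ * c₂ + d₁ * a₂)) (c₁ * d₂ - d₁ * c₂) ≡ k
composition-minors k F a₁ b₁ c₁ d₁ a₂ b₂ c₂ d₂ discs disc≢0 a≢0 lead comp =
  square-determines q k lead a≢0 squares
  where
  q : BinForm
  q = form (a₁ * b₂ - a₂ * b₁) (a₁ * d₂ + c₁ * b₂ - (b₁ * c₂ + d₁ * a₂)) (c₁ * d₂ - d₁ * c₂)
  R : ℤ → ℤ → Mat₂
  R x y = mat (a₁ * x + c₁ * y) (b₁ * x + d₁ * y) (a₂ * x + c₂ * y) (b₂ * x + d₂ * y)
  q≡det : ∀ x y → evalF q x y ≡ det (R x y)
  q≡det = ring a₁ b₁ c₁ d₁ a₂ b₂ c₂ d₂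
    where
    ring : ∀ a₁ b₁ c₁ d₁ a₂ b₂ c₂ d₂ x y →
      (a₁ * b₂ - a₂ * b₁) * x * x + (a₁ * d₂ + c₁ * b₂ - (b₁ * c₂ + d₁ * a₂)) * x * y + (c₁ * d₂ - d₁ * c₂) * y * y
      ≡ (a₁ * x + c₁ * y) * (b₂ * x + d₂ * y) - (b₁ * x + d₁ * y) * (a₂ * x + c₂ * y)
    ring = solve-∀
  F∘R : ∀ x y → F ∘ᶠ R x y ≡ evalF k x y ·ᶠ k
  F∘R x y = evalF-injective _ _ λ z w → begin
    evalF (F ∘ᶠ R x y) z w ≡⟨ evalF-∘ F (R x y) z w ⟩
    evalF F ((a₁ * x + c₁ * y) * z + (b₁ * x + d₁ * y) * w) ((a₂ * x + c₂ * y) * z + (b₂ * x + d₂ * y) * w)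
      ≡⟨ cong₂ (evalF F) (ring a₁ b₁ c₁ d₁ x y z w) (ring a₂ b₂ c₂ d₂ x y z w) ⟩
    evalF F (a₁ * x * z + b₁ * x * w + c₁ * y * z + d₁ * y * w) (a₂ * x * z + b₂ * x * w + c₂ * y * z + d₂ * y * w)
      ≡⟨ comp x y z w ⟨
    evalF k x y * evalF k z w ≡⟨ evalF-· (evalF k x y) k z w ⟨
    evalF (evalF k x y ·ᶠ k) z w ∎
    where
    ring : ∀ a b c d x y z w → (a * x + c * y) * z + (b * x + d * y) * w ≡ a * x * z + b * x * w + c * y * z + d * y * w
    ring = solve-∀
  squares : ∀ x y → evalF q x y * evalF q x y ≡ evalF k x y * evalF k x y
  squares x y = *-cancelˡ (discF k) disc≢0 (begin
    discF k * (evalF q x y * evalF q x y)         ≡⟨ cong (λ i → discF k * (i * i)) (q≡det x y) ⟩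
    discF k * (det (R x y) * det (R x y))         ≡⟨ *-comm (discF k) _ ⟩
    det (R x y) * det (R x y) * discF k           ≡⟨ cong (det (R x y) * det (R x y) *_) discs ⟨
    det (R x y) * det (R x y) * discF F           ≡⟨ discF-∘ F (R x y) ⟨
    discF (F ∘ᶠ R x y)                            ≡⟨ cong discF (F∘R x y) ⟩
    discF (evalF k x y ·ᶠ k)                      ≡⟨ discF-· (evalF k x y) k ⟩
    evalF k x y * evalF k x y * discF k           ≡⟨ *-comm _ (discF k) ⟩
    discF k * (evalF k x y * evalF k x y)         ∎)

-- The two sign conditions in the definition of composition force the bilinear map to be symmetric.
composition-symmetric : ∀ k F a₁ b₁ c₁ d₁ a₂ b₂ c₂ d₂ →
  discF F ≡ discF k → discF k ≢ + 0 → fa k ≢ + 0 → a₁ * b₂ - a₂ * b₁ ≡ fa k → a₁ * c₂ - a₂ * c₁ ≡ fa k →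
  (∀ x y z w → evalF k x y * evalF k z w ≡
    evalF F (a₁ * x * z + b₁ * x * w + c₁ * y * z + d₁ * y * w) (a₂ * x * z + b₂ * x * w + c₂ * y * z + d₂ * y * w)) →
  b₁ ≡ c₁ × b₂ ≡ c₂ × a₁ * d₂ - a₂ * d₁ ≡ fb k × c₁ * d₂ - d₁ * c₂ ≡ fc k
composition-symmetric k F a₁ b₁ c₁ d₁ a₂ b₂ c₂ d₂ discs disc≢0 a≢0 lead lead′ comp =
  b₁≡c₁ , b₂≡c₂ , middle , cong fc minors
  where
  -- Exchanging the two arguments exchanges the b and c coefficients, so the minors can be computed
  -- a second time.
  swapped : ∀ x y z w → evalF k x y * evalF k z w ≡
    evalF F (a₁ * x * z + c₁ * x * w + b₁ * y * z + d₁ * y * w) (a₂ * x * z + c₂ * x * w + b₂ * y * z + d₂ * y * w)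
  swapped x y z w = trans (*-comm (evalF k x y) (evalF k z w)) (trans (comp z w x y)
    (cong₂ (evalF F) (ring a₁ b₁ c₁ d₁ x y z w) (ring a₂ b₂ c₂ d₂ x y z w)))
    where
    ring : ∀ a b c d x y z w → a * z * x + b * z * y + c * w * x + d * w * y ≡ a * x * z + c * x * w + b * y * z + d * y * w
    ring = solve-∀
  minors : form (a₁ * b₂ - a₂ * b₁) (a₁ * d₂ + c₁ * b₂ - (b₁ * c₂ + d₁ * a₂)) (c₁ * d₂ - d₁ * c₂) ≡ k
  minors = composition-minors k F a₁ b₁ c₁ d₁ a₂ b₂ c₂ d₂ discs disc≢0 a≢0 lead comp
  minors′ : form (a₁ * c₂ - a₂ * c₁) (a₁ * d₂ + b₁ * c₂ - (c₁ * b₂ + d₁ * a₂)) (b₁ * d₂ - d₁ * b₂) ≡ k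
  minors′ = composition-minors k F a₁ c₁ b₁ d₁ a₂ c₂ b₂ d₂ discs disc≢0 a≢0 lead′ swapped
  -- The two computed middle coefficients differ by twice this minor. Hence (b₁,b₂) and (c₁,c₂) are
  -- parallel, and their equal nonzero minors against (a₁,a₂) make them equal.
  b∧c : c₁ * b₂ ≡ b₁ * c₂
  b∧c = *-cancelˡ (+ 2) (λ ()) (≡-comb₁ (+ 1) (trans (cong fb minors) (sym (cong fb minors′))) (ring a₁ b₁ c₁ d₁ a₂ b₂ c₂ d₂))
    where
    ring : ∀ a₁ b₁ c₁ d₁ a₂ b₂ c₂ d₂ → + 2 * (c₁ * b₂) - + 2 * (b₁ * c₂) ≡
      + 1 * ((a₁ * d₂ + c₁ * b₂ - (b₁ * c₂ + d₁ * a₂)) - (a₁ * d₂ + b₁ * c₂ - (c₁ * b₂ + d₁ * a₂)))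
    ring = solve-∀
  b₁≡c₁ : b₁ ≡ c₁
  b₁≡c₁ = *-cancelˡ (fa k) a≢0 (begin
    fa k * b₁ ≡⟨ cong (_* b₁) lead′ ⟨
    (a₁ * c₂ - a₂ * c₁) * b₁ ≡⟨ ≡-comb₁ (- a₁) b∧c (ring a₁ b₁ c₁ a₂ b₂ c₂) ⟩
    (a₁ * b₂ - a₂ * b₁) * c₁ ≡⟨ cong (_* c₁) lead ⟩
    fa k * c₁ ∎)
    where
    ring : ∀ a₁ b₁ c₁ a₂ b₂ c₂ → (a₁ * c₂ - a₂ * c₁) * b₁ - (a₁ * b₂ - a₂ * b₁) * c₁ ≡ - a₁ * (c₁ * b₂ - b₁ * c₂)
    ring = solve-∀
  b₂≡c₂ : b₂ ≡ c₂
  b₂≡c₂ = *-cancelˡ (fa k) a≢0 (begin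
    fa k * b₂ ≡⟨ cong (_* b₂) lead′ ⟨
    (a₁ * c₂ - a₂ * c₁) * b₂ ≡⟨ ≡-comb₁ (- a₂) b∧c (ring a₁ b₁ c₁ a₂ b₂ c₂) ⟩
    (a₁ * b₂ - a₂ * b₁) * c₂ ≡⟨ cong (_* c₂) lead ⟩
    fa k * c₂ ∎)
    where
    ring : ∀ a₁ b₁ c₁ a₂ b₂ c₂ → (a₁ * c₂ - a₂ * c₁) * b₂ - (a₁ * b₂ - a₂ * b₁) * c₂ ≡ - a₂ * (c₁ * b₂ - b₁ * c₂)
    ring = solve-∀
  middle : a₁ * d₂ - a₂ * d₁ ≡ fb k
  middle = trans (≡-comb₁ (- + 1) b∧c (ring a₁ b₁ c₁ d₁ a₂ b₂ c₂ d₂)) (cong fb minors)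
    where
    ring : ∀ a₁ b₁ c₁ d₁ a₂ b₂ c₂ d₂ → (a₁ * d₂ - a₂ * d₁) - (a₁ * d₂ + c₁ * b₂ - (b₁ * c₂ + d₁ * a₂)) ≡ - + 1 * (c₁ * b₂ - b₁ * c₂)
    ring = solve-∀

module _ {p : ℕ} (pr : Prime p) where
  open PrimeDivisor pr

  -- Otherwise the value would be divisible by π².
  not-imprimitive : ∀ f x y → evalF f x y ≡ π → ¬ (π ∣ x × π ∣ y)
  not-imprimitive f x y f≡π (divides x′ ex , divides y′ ey) = π∤1 (divides (evalF f x′ y′) (*-cancelˡ π π≢0 (begin
    π * + 1 ≡⟨ *-identityʳ π ⟩
    π ≡⟨ f≡π ⟨
    evalF f x y ≡⟨ cong₂ (evalF f) (trans ex (*-comm x′ π)) (trans ey (*-comm y′ π)) ⟩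
    evalF f (π * x′) (π * y′) ≡⟨ evalF-scale f π x′ y′ ⟩
    π * π * evalF f x′ y′ ≡⟨ *-assoc π π _ ⟩
    π * (π * evalF f x′ y′) ≡⟨ cong (π *_) (*-comm π _) ⟩
    π * (evalF f x′ y′ * π) ∎)))

  -- Combinations of the coordinates of the square of (x,y) give y ∂f/∂x and x ∂f/∂y. If such a
  -- partial derivative vanishes modulo `π` together with f, then so does D y² or D x² respectively.
  -- Either way `π` divides both x and y.
  square-nonzero : ∀ A B C a₁ b₁ d₁ a₂ b₂ d₂ x y → ¬ π ∣ B * B - + 4 * A * C →
    a₁ * b₂ - a₂ * b₁ ≡ A → a₁ * d₂ - a₂ * d₁ ≡ B → b₁ * d₂ - d₁ * b₂ ≡ C →
    evalF (form A B C) x y ≡ π →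
    ¬ (π ∣ a₁ * x * x + b₁ * x * y + b₁ * y * x + d₁ * y * y × π ∣ a₂ * x * x + b₂ * x * y + b₂ * y * x + d₂ * y * y)
  square-nonzero A B C a₁ b₁ d₁ a₂ b₂ d₂ x y π∤D eA eB eC f≡π (π∣m₁ , π∣m₂) =
    not-imprimitive (form A B C) x y f≡π (π∣x , π∣y)
    where
    π∣f : π ∣ A * x * x + B * x * y + C * y * y
    π∣f = subst (π ∣_) (sym f≡π) ∣-refl
    by-y : π ∣ y * (+ 2 * A * x + B * y)
    by-y = ∣-comb₂ a₁ (- a₂) π∣m₂ π∣m₁
      (trans (cong₂ (λ i j → y * (+ 2 * i * x + j * y)) (sym eA) (sym eB)) (ring a₁ b₁ d₁ a₂ b₂ d₂ x y))
      where
      ring : ∀ a₁ b₁ d₁ a₂ b₂ d₂ x y → y * (+ 2 * (a₁ * b₂ - a₂ * b₁) * x + (a₁ * d₂ - a₂ * d₁) * y)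
        ≡ a₁ * (a₂ * x * x + b₂ * x * y + b₂ * y * x + d₂ * y * y) + - a₂ * (a₁ * x * x + b₁ * x * y + b₁ * y * x + d₁ * y * y)
      ring = solve-∀
    by-x : π ∣ x * (B * x + + 2 * C * y)
    by-x = ∣-comb₂ d₂ (- d₁) π∣m₁ π∣m₂
      (trans (cong₂ (λ i j → x * (i * x + + 2 * j * y)) (sym eB) (sym eC)) (ring a₁ b₁ d₁ a₂ b₂ d₂ x y))
      where
      ring : ∀ a₁ c₁ d₁ a₂ c₂ d₂ x y → x * ((a₁ * d₂ - a₂ * d₁) * x + + 2 * (c₁ * d₂ - d₁ * c₂) * y)
        ≡ d₂ * (a₁ * x * x + c₁ * x * y + c₁ * y * x + d₁ * y * y) + - d₁ * (a₂ * x * x + c₂ * x * y + c₂ * y * x + d₂ * y * y)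
      ring = solve-∀
    Dy : ∀ A B C x y → (B * B - + 4 * A * C) * (y * y)
      ≡ (+ 2 * A * x + B * y) * (+ 2 * A * x + B * y) + - (+ 4 * A) * (A * x * x + B * x * y + C * y * y)
    Dy = solve-∀
    Dx : ∀ A B C x y → (B * B - + 4 * A * C) * (x * x)
      ≡ (B * x + + 2 * C * y) * (B * x + + 2 * C * y) + - (+ 4 * C) * (A * x * x + B * x * y + C * y * y)
    Dx = solve-∀
    π∣y : π ∣ y
    π∣y = [ (λ q → q) , (λ q → euclid² (euclidʳ π∤D (∣-comb₂ (+ 2 * A * x + B * y) (- (+ 4 * A)) q π∣f (Dy A B C x y)))) ]′
      (euclid y (+ 2 * A * x + B * y) by-y)
    π∣x : π ∣ x
    π∣x = [ (λ q → q) , (λ q → euclid² (euclidʳ π∤D (∣-comb₂ (B * x + + 2 * C * y) (- (+ 4 * C)) q π∣f (Dx A B C x y)))) ]′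
      (euclid x (B * x + + 2 * C * y) by-x)

  -- (u , v) is a generator of P², where P is the prime ideal over p belonging to a vector at which
  -- the ambiguous form takes the value p; symmetry of the composition excludes P * P̄ = (p).
  ambiguous-norm : ∀ D → ¬ π ∣ D → RepresentedByAmbiguous D π →
    ∃[ b₀ ] ∃[ c₀ ] ∃[ u ] ∃[ v ]
      (b₀ * b₀ - + 4 * c₀ ≡ D × u * u + b₀ * u * v + c₀ * v * v ≡ π * π × ¬ (π ∣ u × π ∣ v))
  ambiguous-norm D π∤D
    ( form A B C , (disc-k , 0<A , _)
    , (F , (disc-F , _) , (a₁ , b₁ , c₁ , d₁ , a₂ , b₂ , c₂ , d₂ , lead , lead′ , comp)
         , (b₀ , c₀ , _ , disc₀ , (α , β , γ , δ , det≡1 , equiv)))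
    , (x , y , k≡π)) =
    b₀ , c₀ , u , v , disc₀ , norm , nonzero
    where
    k : BinForm
    k = form A B C
    A≢0 : A ≢ + 0
    A≢0 A≡0 = <-irrefl (sym A≡0) 0<A
    D≢0 : discF k ≢ + 0
    D≢0 e = π∤D (subst (π ∣_) (trans (sym e) disc-k) (divides (+ 0) refl))
    symmetric : b₁ ≡ c₁ × b₂ ≡ c₂ × a₁ * d₂ - a₂ * d₁ ≡ B × c₁ * d₂ - d₁ * c₂ ≡ C
    symmetric = composition-symmetric k F a₁ b₁ c₁ d₁ a₂ b₂ c₂ d₂ (trans disc-F (sym disc-k)) D≢0 A≢0 lead lead′ comp
    b₁≡c₁ : b₁ ≡ c₁
    b₁≡c₁ = proj₁ symmetric
    b₂≡c₂ : b₂ ≡ c₂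
    b₂≡c₂ = proj₁ (proj₂ symmetric)
    m₁ m₂ u v : ℤ
    m₁ = a₁ * x * x + b₁ * x * y + c₁ * y * x + d₁ * y * y
    m₂ = a₂ * x * x + b₂ * x * y + c₂ * y * x + d₂ * y * y
    -- (`u`, `v`) is (`m₁`, `m₂`) pulled back along the determinant-one substitution that takes `F`
    -- to the principal form.
    u = δ * m₁ - β * m₂
    v = α * m₂ - γ * m₁
    back₁ : α * u + β * v ≡ m₁
    back₁ = ≡-comb₁ m₁ det≡1 (ring α β γ δ m₁ m₂)
      where
      ring : ∀ α β γ δ m₁ m₂ → α * (δ * m₁ - β * m₂) + β * (α * m₂ - γ * m₁) - m₁ ≡ m₁ * (α * δ - β * γ - + 1)
      ring = solve-∀
    back₂ : γ * u + δ * v ≡ m₂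
    back₂ = ≡-comb₁ m₂ det≡1 (ring α β γ δ m₁ m₂)
      where
      ring : ∀ α β γ δ m₁ m₂ → γ * (δ * m₁ - β * m₂) + δ * (α * m₂ - γ * m₁) - m₂ ≡ m₂ * (α * δ - β * γ - + 1)
      ring = solve-∀
    norm : u * u + b₀ * u * v + c₀ * v * v ≡ π * π
    norm = begin
      u * u + b₀ * u * v + c₀ * v * v ≡⟨ cong (λ i → i * u + b₀ * u * v + c₀ * v * v) (*-identityˡ u) ⟨
      evalF (form (+ 1) b₀ c₀) u v ≡⟨ equiv u v ⟨
      evalF F (α * u + β * v) (γ * u + δ * v) ≡⟨ cong₂ (evalF F) back₁ back₂ ⟩
      evalF F m₁ m₂ ≡⟨ comp x y x y ⟨
      evalF k x y * evalF k x y ≡⟨ cong₂ _*_ k≡π k≡π ⟩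
      π * π ∎
    nonzero : ¬ (π ∣ u × π ∣ v)
    nonzero (π∣u , π∣v) = square-nonzero A B C a₁ b₁ d₁ a₂ b₂ d₂ x y (subst (λ i → ¬ π ∣ i) (sym disc-k) π∤D)
      lead (proj₁ (proj₂ (proj₂ symmetric)))
      (trans (cong₂ (λ i j → i * d₂ - d₁ * j) b₁≡c₁ b₂≡c₂) (proj₂ (proj₂ (proj₂ symmetric)))) k≡π
      ( ∣-comb₂ α β π∣u π∣v (trans (cong (λ i → a₁ * x * x + b₁ * x * y + i * y * x + d₁ * y * y) b₁≡c₁) (sym back₁))
      , ∣-comb₂ γ δ π∣u π∣v (trans (cong (λ i → a₂ * x * x + b₂ * x * y + i * y * x + d₂ * y * y) b₂≡c₂) (sym back₂)))

-- Descent from the sublattice of index p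

module Descent {p : ℕ} (pr : Prime p) where
  open PrimeDivisor pr

  π²≢0 : π * π ≢ + 0
  π²≢0 = *-≢0 π π π≢0 π≢0

  U : Mat₂
  U = diag (+ 1) π

  -- Substitute adj(N) z in φ ∘ N ≡ f ∘ U and use N · adj(N) = det N.
  adjugate-eval : ∀ φ f n₁₁ n₁₂ n₂₁ n₂₂ → φ ∘ᶠ mat n₁₁ n₁₂ n₂₁ n₂₂ ≡ f ∘ᶠ U → ∀ x y →
    evalF f (n₂₂ * x - n₁₂ * y) (π * (n₁₁ * y - n₂₁ * x))
      ≡ (n₁₁ * n₂₂ - n₁₂ * n₂₁) * (n₁₁ * n₂₂ - n₁₂ * n₂₁) * evalF φ x y
  adjugate-eval φ f n₁₁ n₁₂ n₂₁ n₂₂ eq x y = begin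
    evalF f X (π * Y) ≡⟨ cong₂ (evalF f) (ring₁ X Y) (ring₂ π X Y) ⟩
    evalF f (+ 1 * X + + 0 * Y) (+ 0 * X + π * Y) ≡⟨ evalF-∘ f U X Y ⟨
    evalF (f ∘ᶠ U) X Y ≡⟨ cong (λ h → evalF h X Y) eq ⟨
    evalF (φ ∘ᶠ mat n₁₁ n₁₂ n₂₁ n₂₂) X Y ≡⟨ evalF-∘ φ (mat n₁₁ n₁₂ n₂₁ n₂₂) X Y ⟩
    evalF φ (n₁₁ * X + n₁₂ * Y) (n₂₁ * X + n₂₂ * Y) ≡⟨ cong₂ (evalF φ) (ring₃ n₁₁ n₁₂ n₂₁ n₂₂ x y) (ring₄ n₁₁ n₁₂ n₂₁ n₂₂ x y) ⟩
    evalF φ (d * x) (d * y) ≡⟨ evalF-scale φ d x y ⟩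
    d * d * evalF φ x y ∎
    where
    X Y d : ℤ
    X = n₂₂ * x - n₁₂ * y
    Y = n₁₁ * y - n₂₁ * x
    d = n₁₁ * n₂₂ - n₁₂ * n₂₁
    ring₁ : ∀ X Y → X ≡ + 1 * X + + 0 * Y
    ring₁ = solve-∀
    ring₂ : ∀ π X Y → π * Y ≡ + 0 * X + π * Y
    ring₂ = solve-∀
    ring₃ : ∀ n₁₁ n₁₂ n₂₁ n₂₂ x y → n₁₁ * (n₂₂ * x - n₁₂ * y) + n₁₂ * (n₁₁ * y - n₂₁ * x) ≡ (n₁₁ * n₂₂ - n₁₂ * n₂₁) * x
    ring₃ = solve-∀
    ring₄ : ∀ n₁₁ n₁₂ n₂₁ n₂₂ x y → n₂₁ * (n₂₂ * x - n₁₂ * y) + n₂₂ * (n₁₁ * y - n₂₁ * x) ≡ (n₁₁ * n₂₂ - n₁₂ * n₂₁) * y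
    ring₄ = solve-∀

  -- The rational matrix N U⁻¹ carries `φ` to `f` but need not be integral. Following it by the
  -- rational isometry U V / π of `f` replaces it by N V / π, which is the integral matrix `N′`.
  divide-out : ∀ φ f N V N′ → φ ∘ᶠ N ≡ f ∘ᶠ U → f ∘ᶠ (U ∙ V) ≡ (π * π) ·ᶠ f → N ∙ V ≡ N′ ∙ scalar π → φ ∘ᶠ N′ ≡ f
  divide-out φ f N V N′ eq similar NV = ·ᶠ-cancel (π * π) π²≢0 (φ ∘ᶠ N′) f (begin
    (π * π) ·ᶠ (φ ∘ᶠ N′)       ≡⟨ ∘ᶠ-scalar (φ ∘ᶠ N′) π ⟨
    φ ∘ᶠ N′ ∘ᶠ scalar π        ≡⟨ ∘ᶠ-∙ φ N′ (scalar π) ⟩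
    φ ∘ᶠ (N′ ∙ scalar π)       ≡⟨ cong (φ ∘ᶠ_) NV ⟨
    φ ∘ᶠ (N ∙ V)               ≡⟨ ∘ᶠ-∙ φ N V ⟨
    φ ∘ᶠ N ∘ᶠ V                ≡⟨ cong (_∘ᶠ V) eq ⟩
    f ∘ᶠ U ∘ᶠ V                ≡⟨ ∘ᶠ-∙ f U V ⟩
    f ∘ᶠ (U ∙ V)               ≡⟨ similar ⟩
    (π * π) ·ᶠ f               ∎)

  -- Here V is the adjugate of `U`, so that U V is the scalar `π` and N U⁻¹ itself is integral.
  divisible-column : ∀ φ f n₁₁ n₁₂ n₂₁ n₂₂ → φ ∘ᶠ mat n₁₁ n₁₂ n₂₁ n₂₂ ≡ f ∘ᶠ U →
    π ∣ n₁₂ → π ∣ n₂₂ → ∃[ N′ ] (φ ∘ᶠ N′ ≡ f)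
  divisible-column φ f n₁₁ n₁₂ n₂₁ n₂₂ eq (divides q₁ e₁) (divides q₂ e₂) =
    N′ , divide-out φ f (mat n₁₁ n₁₂ n₂₁ n₂₂) (diag π (+ 1)) N′ eq
      (trans (cong (f ∘ᶠ_) (mat-≡ (r₁ π) refl (r₃ π) (r₄ π))) (∘ᶠ-scalar f π))
      (mat-≡ (r₅ n₁₁ n₁₂ q₁ π) (trans (r₆ n₁₁ n₁₂) (trans e₁ (r₇ n₁₁ q₁ π)))
             (r₅ n₂₁ n₂₂ q₂ π) (trans (r₆ n₂₁ n₂₂) (trans e₂ (r₇ n₂₁ q₂ π))))
    where
    N′ : Mat₂
    N′ = mat n₁₁ q₁ n₂₁ q₂
    r₁ : ∀ π → + 1 * π + + 0 * + 0 ≡ π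
    r₁ = solve-∀
    r₃ : ∀ π → + 0 * π + π * + 0 ≡ + 0
    r₃ = solve-∀
    r₄ : ∀ π → + 0 * + 0 + π * + 1 ≡ π
    r₄ = solve-∀
    r₅ : ∀ i j q π → i * π + j * + 0 ≡ i * π + q * + 0
    r₅ = solve-∀
    r₆ : ∀ i j → i * + 0 + j * + 1 ≡ j
    r₆ = solve-∀
    r₇ : ∀ i q π → q * π ≡ i * + 0 + q * π
    r₇ = solve-∀

  -- The second coordinate of U adj(N) z is a multiple of `π`, so modulo `π` the value of `g` there
  -- is `fa g` times the square of the first, n₂₂ x - n₁₂ y. By `odd-valuation` it vanishes for
  -- every z, which makes the second column of N divisible by `π`.
  descent-odd : ∀ φ s g n₁₁ n₁₂ n₂₁ n₂₂ → EvenVal s → ¬ π ∣ fa g →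
    φ ∘ᶠ mat n₁₁ n₁₂ n₂₁ n₂₂ ≡ ((s * π) ·ᶠ g) ∘ᶠ U →
    ∀ x₀ y₀ → ¬ π ∣ evalF φ x₀ y₀ → ∃[ N′ ] (φ ∘ᶠ N′ ≡ (s * π) ·ᶠ g)
  descent-odd φ s g@(form a b c) n₁₁ n₁₂ n₂₁ n₂₂ even π∤a eq x₀ y₀ π∤φ =
    divisible-column φ ((s * π) ·ᶠ g) n₁₁ n₁₂ n₂₁ n₂₂ eq
      (euclid² (euclidʳ π∤a (∣-comb₂ (+ 1) (b * n₁₂ * n₁₁ + - (c * n₁₁ * n₁₁ * π)) (isotropic (+ 0) (+ 1)) ∣-refl (ring₁ a b c n₁₁ n₁₂ n₂₁ n₂₂ π))))
      (euclid² (euclidʳ π∤a (∣-comb₂ (+ 1) (b * n₂₂ * n₂₁ + - (c * n₂₁ * n₂₁ * π)) (isotropic (+ 1) (+ 0)) ∣-refl (ring₂ a b c n₁₁ n₁₂ n₂₁ n₂₂ π))))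
    where
    isotropic : ∀ x y → π ∣ evalF g (n₂₂ * x - n₁₂ * y) (π * (n₁₁ * y - n₂₁ * x))
    isotropic = odd-valuation (λ x y → evalF g (n₂₂ * x - n₁₂ * y) (π * (n₁₁ * y - n₂₁ * x))) (evalF φ) even
      (n₁₁ * n₂₂ - n₁₂ * n₂₁)
      (λ x y → trans (sym (evalF-· (s * π) g _ _)) (adjugate-eval φ ((s * π) ·ᶠ g) n₁₁ n₁₂ n₂₁ n₂₂ eq x y)) x₀ y₀ π∤φ
    ring₁ : ∀ a b c n₁₁ n₁₂ n₂₁ n₂₂ π → a * (n₁₂ * n₁₂) ≡ + 1 *
      (a * (n₂₂ * + 0 - n₁₂ * + 1) * (n₂₂ * + 0 - n₁₂ * + 1) + b * (n₂₂ * + 0 - n₁₂ * + 1) * (π * (n₁₁ * + 1 - n₂₁ * + 0))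
        + c * (π * (n₁₁ * + 1 - n₂₁ * + 0)) * (π * (n₁₁ * + 1 - n₂₁ * + 0)))
      + (b * n₁₂ * n₁₁ + - (c * n₁₁ * n₁₁ * π)) * π
    ring₁ = solve-∀
    ring₂ : ∀ a b c n₁₁ n₁₂ n₂₁ n₂₂ π → a * (n₂₂ * n₂₂) ≡ + 1 *
      (a * (n₂₂ * + 1 - n₁₂ * + 0) * (n₂₂ * + 1 - n₁₂ * + 0) + b * (n₂₂ * + 1 - n₁₂ * + 0) * (π * (n₁₁ * + 0 - n₂₁ * + 1))
        + c * (π * (n₁₁ * + 0 - n₂₁ * + 1)) * (π * (n₁₁ * + 0 - n₂₁ * + 1)))
      + (b * n₂₂ * n₂₁ + - (c * n₂₁ * n₂₁ * π)) * π
    ring₂ = solve-∀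

  -- The matrix is U⁻¹ times multiplication by the element of norm p² with coordinates (w , v).
  similitude : ∀ s a′ b c w v w′ → w + v * b ≡ w′ * π → w * w + b * w * v + a′ * π * c * v * v ≡ π * π →
    (s ·ᶠ form (a′ * π) b c) ∘ᶠ (U ∙ mat w (- (v * c)) (v * a′) w′) ≡ (π * π) ·ᶠ (s ·ᶠ form (a′ * π) b c)
  similitude s a′ b c w v w′ ew norm =
    trans (cong (s ·ᶠ g ∘ᶠ_) (mat-≡ (r₁ w (v * a′)) (r₁ (- (v * c)) w′) (r₂ w v a′ π) (trans (r₃ (- (v * c)) w′ π) (sym ew))))
      (trans (·ᶠ-∘ᶠ s g W) (trans (cong (s ·ᶠ_) g∘W) swap))
    where
    g : BinForm
    g = form (a′ * π) b c
    W : Mat₂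
    -- Multiplication by w + v ω on a lattice with norm form `g`, where ω² = b ω - a c and a is the
    -- leading coefficient a′ π; its determinant is the norm w² + b w v + a c v².
    W = mat w (- (v * c)) (v * (a′ * π)) (w + v * b)
    r₁ : ∀ i j → + 1 * i + + 0 * j ≡ i
    r₁ = solve-∀
    r₂ : ∀ w v a′ π → + 0 * w + π * (v * a′) ≡ v * (a′ * π)
    r₂ = solve-∀
    r₃ : ∀ i j π → + 0 * i + π * j ≡ j * π
    r₃ = solve-∀
    g∘W : g ∘ᶠ W ≡ (π * π) ·ᶠ g
    g∘W = trans (form-≡ (e₁ (a′ * π) b c w v) (e₂ (a′ * π) b c w v) (e₃ (a′ * π) b c w v)) (cong (_·ᶠ g) norm)
      where
      e₁ : ∀ a b c w v → a * w * w + b * w * (v * a) + c * (v * a) * (v * a) ≡ (w * w + b * w * v + a * c * v * v) * a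
      e₁ = solve-∀
      e₂ : ∀ a b c w v → + 2 * a * w * (- (v * c)) + b * (w * (w + v * b) + - (v * c) * (v * a)) + + 2 * c * (v * a) * (w + v * b)
        ≡ (w * w + b * w * v + a * c * v * v) * b
      e₂ = solve-∀
      e₃ : ∀ a b c w v → a * - (v * c) * - (v * c) + b * - (v * c) * (w + v * b) + c * (w + v * b) * (w + v * b)
        ≡ (w * w + b * w * v + a * c * v * v) * c
      e₃ = solve-∀
    swap : s ·ᶠ ((π * π) ·ᶠ g) ≡ (π * π) ·ᶠ (s ·ᶠ g)
    swap = form-≡ (r s (π * π) (a′ * π)) (r s (π * π) b) (r s (π * π) c)
      where
      r : ∀ s q a → s * (q * a) ≡ q * (s * a)
      r = solve-∀

  -- An element w + v ω of norm π², not divisible by `π`, where ω² = b ω - a c. The quadratic form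
  -- in `norm` is the principal form of the discriminant of `g`, written in coordinates adapted to
  -- `g`.
  record SplitNorm (g : BinForm) : Set where
    field
      w v     : ℤ
      norm    : w * w + fb g * w * v + fa g * fc g * v * v ≡ π * π
      nonzero : ¬ (π ∣ w × π ∣ v)

-- Descent along an isotropic line

module EvenDescent {p : ℕ} (pr : Prime p) where
  open PrimeDivisor pr
  open Descent pr

  -- Substituting `U` extracts a factor `π` and leaves h = a′ X² + b X Y + π c Y², which is X (a′ X
  -- + b Y) modulo `π`. `odd-valuation` makes h vanish on the image of adj(N), and `same-factor`
  -- selects one linear factor.
  isotropic-lines : ∀ φ s a′ b c n₁₁ n₁₂ n₂₁ n₂₂ → EvenVal s →
    φ ∘ᶠ mat n₁₁ n₁₂ n₂₁ n₂₂ ≡ (s ·ᶠ form (a′ * π) b c) ∘ᶠ U → ∀ x₀ y₀ → ¬ π ∣ evalF φ x₀ y₀ →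
    (π ∣ n₂₂ × π ∣ - n₁₂) ⊎ (π ∣ a′ * n₂₂ - b * n₂₁ × π ∣ b * n₁₁ - a′ * n₁₂)
  isotropic-lines φ s a′ b c n₁₁ n₁₂ n₂₁ n₂₂ even eq x₀ y₀ π∤φ =
    same-factor n₂₂ (- n₁₂) (a′ * n₂₂ - b * n₂₁) (b * n₁₁ - a′ * n₁₂)
      (∣-comb₁ (+ 1) (line (+ 1) (+ 0)) (at₁ a′ b n₁₁ n₁₂ n₂₁ n₂₂))
      (∣-comb₁ (+ 1) (line (+ 0) (+ 1)) (at₂ a′ b n₁₁ n₁₂ n₂₁ n₂₂))
      (∣-comb₁ (+ 1) (line (+ 1) (+ 1)) (at₃ a′ b n₁₁ n₁₂ n₂₁ n₂₂))
    where
    X Y H : ℤ → ℤ → ℤ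
    X x y = n₂₂ * x - n₁₂ * y
    Y x y = n₁₁ * y - n₂₁ * x
    H x y = a′ * X x y * X x y + b * X x y * Y x y + π * c * Y x y * Y x y
    scaled : ∀ s a′ b c π X Y → s * π * (a′ * X * X + b * X * Y + π * c * Y * Y)
      ≡ s * (a′ * π) * X * X + s * b * X * (π * Y) + s * c * (π * Y) * (π * Y)
    scaled = solve-∀
    isotropic : ∀ x y → π ∣ H x y
    isotropic = odd-valuation H (evalF φ) even (n₁₁ * n₂₂ - n₁₂ * n₂₁)
      (λ x y → trans (scaled s a′ b c π (X x y) (Y x y))
        (adjugate-eval φ (s ·ᶠ form (a′ * π) b c) n₁₁ n₁₂ n₂₁ n₂₂ eq x y)) x₀ y₀ π∤φ
    line : ∀ x y → π ∣ X x y * (a′ * X x y + b * Y x y)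
    line x y = ∣-comb₂ (+ 1) (- (c * Y x y * Y x y)) (isotropic x y) ∣-refl (ring a′ b c π (X x y) (Y x y))
      where
      ring : ∀ a′ b c π X Y → X * (a′ * X + b * Y) ≡ + 1 * (a′ * X * X + b * X * Y + π * c * Y * Y) + - (c * Y * Y) * π
      ring = solve-∀
    at₁ : ∀ a′ b n₁₁ n₁₂ n₂₁ n₂₂ → n₂₂ * (a′ * n₂₂ - b * n₂₁) ≡ + 1 * ((n₂₂ * + 1 - n₁₂ * + 0)
      * (a′ * (n₂₂ * + 1 - n₁₂ * + 0) + b * (n₁₁ * + 0 - n₂₁ * + 1)))
    at₁ = solve-∀
    at₂ : ∀ a′ b n₁₁ n₁₂ n₂₁ n₂₂ → - n₁₂ * (b * n₁₁ - a′ * n₁₂) ≡ + 1 * ((n₂₂ * + 0 - n₁₂ * + 1)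
      * (a′ * (n₂₂ * + 0 - n₁₂ * + 1) + b * (n₁₁ * + 1 - n₂₁ * + 0)))
    at₂ = solve-∀
    at₃ : ∀ a′ b n₁₁ n₁₂ n₂₁ n₂₂ → (n₂₂ + - n₁₂) * (a′ * n₂₂ - b * n₂₁ + (b * n₁₁ - a′ * n₁₂)) ≡ + 1 * ((n₂₂ * + 1 - n₁₂ * + 1)
      * (a′ * (n₂₂ * + 1 - n₁₂ * + 1) + b * (n₁₁ * + 1 - n₂₁ * + 1)))
    at₃ = solve-∀

  -- The hypotheses make each row of N proportional to (a′, b) modulo `π`. Such rows annihilate both
  -- columns of the matrix in `similitude`: the first because w ≡ - v b, the second because of
  -- `π∣key`. So N V is divisible by `π`.
  second-line : ∀ φ s a′ b c n₁₁ n₁₂ n₂₁ n₂₂ w v w′ → ¬ π ∣ b →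
    w + v * b ≡ w′ * π → w * w + b * w * v + a′ * π * c * v * v ≡ π * π → ¬ (π ∣ w × π ∣ v) →
    φ ∘ᶠ mat n₁₁ n₁₂ n₂₁ n₂₂ ≡ (s ·ᶠ form (a′ * π) b c) ∘ᶠ U →
    π ∣ a′ * n₂₂ - b * n₂₁ → π ∣ b * n₁₁ - a′ * n₁₂ → ∃[ N′ ] (φ ∘ᶠ N′ ≡ s ·ᶠ form (a′ * π) b c)
  second-line φ s a′ b c n₁₁ n₁₂ n₂₁ n₂₂ w v w′ π∤b ew norm nonzero eq h₂ h₁ =
    N′ , divide-out φ (s ·ᶠ form (a′ * π) b c) (mat n₁₁ n₁₂ n₂₁ n₂₂) (mat w (- (v * c)) (v * a′) w′) N′ eq
      (similitude s a′ b c w v w′ ew norm)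
      (mat-≡ (trans (_∣_.equality d₁₁) (z₁ (quotient d₁₁) (quotient d₁₂) π))
             (trans (_∣_.equality d₁₂) (z₂ (quotient d₁₁) (quotient d₁₂) π))
             (trans (_∣_.equality d₂₁) (z₁ (quotient d₂₁) (quotient d₂₂) π))
             (trans (_∣_.equality d₂₂) (z₂ (quotient d₂₁) (quotient d₂₂) π)))
    where
    z₁ : ∀ i j π → i * π ≡ i * π + j * + 0
    z₁ = solve-∀
    z₂ : ∀ i j π → j * π ≡ i * + 0 + j * π
    z₂ = solve-∀
    π∤v : ¬ π ∣ v
    π∤v π∣v = nonzero (∣-comb₂ w′ (- b) ∣-refl π∣v (trans (sym (ring w v b)) (cong (_+ - b * v) ew)) , π∣v)
      where
      ring : ∀ w v b → w + v * b + - b * v ≡ w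
      ring = solve-∀
    -- Divide the norm equation by p and use w ≡ - v b.
    π∣key : π ∣ b * w′ - v * a′ * c
    π∣key = euclidʳ π∤v (divides (w′ * w′ - + 1) (*-cancelˡ π π≢0
      (≡-comb₂ (w′ * π + w) (- + 1) ew norm (ring a′ b c w v w′ π))))
      where
      ring : ∀ a′ b c w v w′ π → π * (v * (b * w′ - v * a′ * c)) - π * ((w′ * w′ - + 1) * π)
        ≡ (w′ * π + w) * (w + v * b - w′ * π) + - + 1 * (w * w + b * w * v + a′ * π * c * v * v - π * π)
      ring = solve-∀
    first : ∀ i j → π ∣ b * i - a′ * j → π ∣ i * w + j * (v * a′)
    first i j h = ∣-comb₂ (i * w′) (- v) ∣-refl h (≡-comb₁ i ew (ring a′ b w v w′ π i j))
      where
      ring : ∀ a′ b w v w′ π i j → i * w + j * (v * a′) - (i * w′ * π + - v * (b * i - a′ * j)) ≡ i * (w + v * b - w′ * π)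
      ring = solve-∀
    second : ∀ i j → π ∣ b * i - a′ * j → π ∣ i * - (v * c) + j * w′
    second i j h = euclidʳ π∤b (∣-comb₂ (- (v * c)) j h π∣key (ring a′ b c v w′ i j))
      where
      ring : ∀ a′ b c v w′ i j → b * (i * - (v * c) + j * w′) ≡ - (v * c) * (b * i - a′ * j) + j * (b * w′ - v * a′ * c)
      ring = solve-∀
    h₂′ : π ∣ b * n₂₁ - a′ * n₂₂
    h₂′ = ∣-comb₁ (- + 1) h₂ (ring (a′ * n₂₂) (b * n₂₁))
      where
      ring : ∀ i j → j - i ≡ - + 1 * (i - j)
      ring = solve-∀
    d₁₁ : π ∣ n₁₁ * w + n₁₂ * (v * a′)
    d₁₁ = first n₁₁ n₁₂ h₁
    d₁₂ : π ∣ n₁₁ * - (v * c) + n₁₂ * w′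
    d₁₂ = second n₁₁ n₁₂ h₁
    d₂₁ : π ∣ n₂₁ * w + n₂₂ * (v * a′)
    d₂₁ = first n₂₁ n₂₂ h₂′
    d₂₂ : π ∣ n₂₁ * - (v * c) + n₂₂ * w′
    d₂₂ = second n₂₁ n₂₂ h₂′
    N′ : Mat₂
    N′ = mat (quotient d₁₁) (quotient d₁₂) (quotient d₂₁) (quotient d₂₂)

  -- Since `π` divides `fa g`, the norm equation gives w (w + v b) ≡ 0 modulo `π`. Thus the given
  -- element or its conjugate meets the congruence required by `second-line`.
  descent-even : ∀ φ s g n₁₁ n₁₂ n₂₁ n₂₂ → EvenVal s → π ∣ fa g → ¬ π ∣ fb g → SplitNorm g →
    φ ∘ᶠ mat n₁₁ n₁₂ n₂₁ n₂₂ ≡ (s ·ᶠ g) ∘ᶠ U →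
    ∀ x₀ y₀ → ¬ π ∣ evalF φ x₀ y₀ → ∃[ N′ ] (φ ∘ᶠ N′ ≡ s ·ᶠ g)
  descent-even φ s (form .(a′ * π) b c) n₁₁ n₁₂ n₂₁ n₂₂ even (divides a′ refl) π∤b
    record { w = w ; v = v ; norm = norm ; nonzero = nonzero } eq x₀ y₀ π∤φ =
    [ (λ h → divisible-column φ (s ·ᶠ form (a′ * π) b c) n₁₁ n₁₂ n₂₁ n₂₂ eq
               (∣-comb₁ (- + 1) (proj₂ h) (neg n₁₂)) (proj₁ h))
    -- (w + v b, - v) are the coordinates of the conjugate of w + v ω.
    , (λ h → [ (λ π∣w → second-line φ s a′ b c n₁₁ n₁₂ n₂₁ n₂₂ (w + v * b) (- v) (quotient π∣w) π∤b
                   (trans (conj w v b) (_∣_.equality π∣w)) (trans (conj-norm (a′ * π) b c w v) norm)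
                   (λ { (h₁ , h₂) → nonzero (π∣w , ∣-comb₁ (- + 1) h₂ (neg v)) })
                   eq (proj₁ h) (proj₂ h))
             , (λ { (divides w′ ew) → second-line φ s a′ b c n₁₁ n₁₂ n₂₁ n₂₂ w v w′ π∤b ew norm nonzero eq (proj₁ h) (proj₂ h) })
             ]′ product)
    ]′ (isotropic-lines φ s a′ b c n₁₁ n₁₂ n₂₁ n₂₂ even eq x₀ y₀ π∤φ)
    where
    neg : ∀ i → i ≡ - + 1 * - i
    neg = solve-∀
    conj : ∀ w v b → w + v * b + - v * b ≡ w
    conj = solve-∀
    conj-norm : ∀ a b c w v → (w + v * b) * (w + v * b) + b * (w + v * b) * - v + a * c * - v * - v
      ≡ w * w + b * w * v + a * c * v * v
    conj-norm = solve-∀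
    product : (π ∣ w) ⊎ (π ∣ w + v * b)
    product = euclid w (w + v * b) (divides (π - a′ * c * v * v) (≡-comb₁ (+ 1) norm (ring a′ b c w v π)))
      where
      ring : ∀ a′ b c w v π → w * (w + v * b) - (π - a′ * c * v * v) * π ≡ + 1 * (w * w + b * w * v + a′ * π * c * v * v - π * π)
      ring = solve-∀

-- Choice of a basis adapted to the parity

module BaseChange {p : ℕ} (pr : Prime p) where
  open PrimeDivisor pr
  open Descent pr
  open EvenDescent pr

  record Basis : Set where
    field
      S S⁻¹    : Mat₂
      inverse  : S ∙ S⁻¹ ≡ scalar (+ 1)
      det≡1    : det S ≡ + 1

  open Basis

  standard : Basis
  standard = record { S = scalar (+ 1) ; S⁻¹ = scalar (+ 1) ; inverse = refl ; det≡1 = refl }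

  -- The new first basis vector is (x, 1), so the new leading coefficient is the value of the form
  -- there.
  through : ℤ → Basis
  through x = record
    { S = mat x (- + 1) (+ 1) (+ 0) ; S⁻¹ = mat (+ 0) (+ 1) (- + 1) x
    ; inverse = mat-≡ (r₁ x) (r₂ x) refl (r₃ x) ; det≡1 = r₄ x }
    where
    r₁ : ∀ x → x * + 0 + - + 1 * - + 1 ≡ + 1
    r₁ = solve-∀
    r₂ : ∀ x → x * + 1 + - + 1 * x ≡ + 0
    r₂ = solve-∀
    r₃ : ∀ x → + 1 * + 1 + + 0 * x ≡ + 1
    r₃ = solve-∀
    r₄ : ∀ x → x * + 0 - - + 1 * + 1 ≡ + 1
    r₄ = solve-∀

  discF-basis : ∀ g β → discF (g ∘ᶠ S β) ≡ discF g
  discF-basis g β = trans (discF-∘ g (S β)) (trans (cong (λ d → d * d * discF g) (det≡1 β)) (*-identityˡ (discF g)))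

  -- Both norm forms are monic of discriminant D. Their middle coefficients agree modulo 2, because
  -- b² - b₀² = 4(ac - c₀), so with b = b₀ + 2j the shift w = u - v j carries one to the other.
  split-norm : ∀ D → ∃[ b₀ ] ∃[ c₀ ] ∃[ u ] ∃[ v ]
      (b₀ * b₀ - + 4 * c₀ ≡ D × u * u + b₀ * u * v + c₀ * v * v ≡ π * π × ¬ (π ∣ u × π ∣ v)) →
    ∀ g → discF g ≡ D → SplitNorm g
  split-norm D (b₀ , c₀ , u , v , disc₀ , norm₀ , nonzero₀) (form a b c) disc-g = finish parity₂
    where
    module Two = PrimeDivisor prime[2]
    product : + 2 ∣ (b - b₀) * (b + b₀)
    product = divides (+ 2 * (a * c - c₀)) (≡-comb₁ (+ 1) (trans disc-g (sym disc₀)) (ring a b c b₀ c₀))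
      where
      ring : ∀ a b c b₀ c₀ → (b - b₀) * (b + b₀) - + 2 * (a * c - c₀) * + 2 ≡ + 1 * (b * b - + 4 * a * c - (b₀ * b₀ - + 4 * c₀))
      ring = solve-∀
    parity₂ : + 2 ∣ b - b₀
    parity₂ = [ (λ h → h) , (λ h → ∣-comb₂ (+ 1) (- b₀) h ∣-refl (ring b b₀)) ]′ (Two.euclid (b - b₀) (b + b₀) product)
      where
      ring : ∀ b b₀ → b - b₀ ≡ + 1 * (b + b₀) + - b₀ * + 2
      ring = solve-∀
    finish : + 2 ∣ b - b₀ → SplitNorm (form a b c)
    finish (divides j ej) = record { w = u - v * j ; v = v ; norm = trans norm≡ norm₀ ; nonzero = nonzero }
      where
      norm≡ : (u - v * j) * (u - v * j) + b * (u - v * j) * v + a * c * v * v ≡ u * u + b₀ * u * v + c₀ * v * v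
      norm≡ = *-cancelˡ (+ 4) (λ ()) (≡-comb₂ (- (v * v)) (+ 4 * (u - v * j) * v + v * v * (b + b₀ + + 2 * j))
        (trans disc-g (sym disc₀)) ej (ring a b c b₀ c₀ u v j))
        where
        ring : ∀ a b c b₀ c₀ u v j →
          + 4 * ((u - v * j) * (u - v * j) + b * (u - v * j) * v + a * c * v * v) - + 4 * (u * u + b₀ * u * v + c₀ * v * v)
          ≡ - (v * v) * (b * b - + 4 * a * c - (b₀ * b₀ - + 4 * c₀))
            + (+ 4 * (u - v * j) * v + v * v * (b + b₀ + + 2 * j)) * (b - b₀ - j * + 2)
        ring = solve-∀
      nonzero : ¬ (π ∣ u - v * j × π ∣ v)
      nonzero (h₁ , h₂) = nonzero₀ (∣-comb₂ (+ 1) j h₁ h₂ (ring u v j) , h₂)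
        where
        ring : ∀ u v j → u ≡ + 1 * (u - v * j) + j * v
        ring = solve-∀

  -- g(w, v a) is a times the norm π², so (w, v a) is isotropic modulo `π`. If a is a unit then so
  -- is v, and scaling by an inverse y of v a gives the vector (w y, 1).
  isotropic-basis : ∀ g → SplitNorm g → ∃[ β ] (π ∣ fa (g ∘ᶠ S β))
  isotropic-basis (form a b c) record { w = w ; v = v ; norm = norm ; nonzero = nonzero } with π ∣? a
  ... | yes π∣a = standard , ∣-comb₁ (+ 1) π∣a (ring a b c)
    where
    ring : ∀ a b c → a * + 1 * + 1 + b * + 1 * + 0 + c * + 0 * + 0 ≡ + 1 * a
    ring = solve-∀
  ... | no π∤a = through (w * y) , ∣-comb₂ (y * y * a * π) (- (b * (w * y) + c * (y * (v * a) + + 1))) ∣-refl y-inverse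
          (≡-comb₁ (y * y * a) norm (ring a b c w v y π))
    where
    π∤v : ¬ π ∣ v
    π∤v π∣v = nonzero (euclid² (∣-comb₂ π (- (b * w + a * c * v)) ∣-refl π∣v (≡-comb₁ (+ 1) norm (ring a b c w v π))) , π∣v)
      where
      ring : ∀ a b c w v π → w * w - (π * π + - (b * w + a * c * v) * v) ≡ + 1 * (w * w + b * w * v + a * c * v * v - π * π)
      ring = solve-∀
    y : ℤ
    y = proj₁ (invert {v * a} (λ h → [ π∤v , π∤a ]′ (euclid v a h)))
    y-inverse : π ∣ y * (v * a) - + 1
    y-inverse = proj₂ (invert {v * a} (λ h → [ π∤v , π∤a ]′ (euclid v a h)))
    ring : ∀ a b c w v y π → a * (w * y) * (w * y) + b * (w * y) * + 1 + c * + 1 * + 1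
      - (y * y * a * π * π + - (b * (w * y) + c * (y * (v * a) + + 1)) * (y * (v * a) - + 1))
      ≡ y * y * a * (w * w + b * w * v + a * c * v * v - π * π)
    ring = solve-∀

  -- A form vanishing modulo `π` at (1,0), (0,1) and (1,1) has all coefficients divisible by `π`;
  -- the three bases start with these vectors.
  unit-basis : ∀ g → ¬ (π ∣ fa g × π ∣ fb g × π ∣ fc g) → ∃[ β ] (¬ π ∣ fa (g ∘ᶠ S β))
  unit-basis (form a b c) content with π ∣? a | π ∣? c
  ... | no π∤a  | _       = standard , λ h → π∤a (∣-comb₁ (+ 1) h (ring a b c))
    where
    ring : ∀ a b c → a ≡ + 1 * (a * + 1 * + 1 + b * + 1 * + 0 + c * + 0 * + 0)
    ring = solve-∀
  ... | yes π∣a | no π∤c  = through (+ 0) , λ h → π∤c (∣-comb₁ (+ 1) h (ring a b c))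
    where
    ring : ∀ a b c → c ≡ + 1 * (a * + 0 * + 0 + b * + 0 * + 1 + c * + 1 * + 1)
    ring = solve-∀
  ... | yes π∣a | yes π∣c = through (+ 1) , λ h → content (π∣a , ∣-comb₃ (+ 1) (- + 1) (- + 1) h π∣a π∣c (ring a b c) , π∣c)
    where
    ring : ∀ a b c → b ≡ + 1 * (a * + 1 * + 1 + b * + 1 * + 1 + c * + 1 * + 1) + - + 1 * a + - + 1 * c
    ring = solve-∀

  -- The common outcome of the two parity cases, in the shape that contradicts isolation.
  Descends : BinForm → Set
  Descends f = ∀ φ N → φ ∘ᶠ N ≡ f ∘ᶠ U → ∀ x₀ y₀ → ¬ π ∣ evalF φ x₀ y₀ → ∃[ N′ ] (φ ∘ᶠ N′ ≡ f)

  descending-basis : ∀ s g D → s ≢ + 0 → discF g ≡ D → ¬ π ∣ D → RepresentedByAmbiguous D π →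
    ¬ (π ∣ fa g × π ∣ fb g × π ∣ fc g) → ∃[ β ] Descends ((s ·ᶠ g) ∘ᶠ S β)
  descending-basis s g D s≢0 disc-g π∤D ambiguous content = [ even-case , odd-case ]′ (parity s s≢0)
    where
    -- Stated for every form of discriminant D: it is applied to `g` to find the isotropic line, and
    -- again after the change of basis.
    norms : ∀ h → discF h ≡ D → SplitNorm h
    norms = split-norm D (ambiguous-norm pr D π∤D ambiguous)
    even-case : EvenVal s → ∃[ β ] Descends ((s ·ᶠ g) ∘ᶠ S β)
    even-case even = go (isotropic-basis g (norms g disc-g))
      where
      go : ∃[ β ] (π ∣ fa (g ∘ᶠ S β)) → ∃[ β ] Descends ((s ·ᶠ g) ∘ᶠ S β)
      go (β , π∣a) = β , subst Descends (sym (·ᶠ-∘ᶠ s g (S β))) λ φ N eq →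
        descent-even φ s h (m₁₁ N) (m₁₂ N) (m₂₁ N) (m₂₂ N) even π∣a π∤b (norms h disc-h) eq
        where
        h : BinForm
        h = g ∘ᶠ S β
        disc-h : discF h ≡ D
        disc-h = trans (discF-basis g β) disc-g
        -- With `π` dividing the leading coefficient, D ≡ b² modulo `π`.
        π∤b : ¬ π ∣ fb h
        π∤b π∣b = π∤D (∣-comb₂ (fb h) (- (+ 4 * fc h)) π∣b π∣a (trans (sym disc-h) (ring (fa h) (fb h) (fc h))))
          where
          ring : ∀ a b c → b * b - + 4 * a * c ≡ b * b + - (+ 4 * c) * a
          ring = solve-∀
    odd-case : ∃[ t ] (EvenVal t × s ≡ t * π) → ∃[ β ] Descends ((s ·ᶠ g) ∘ᶠ S β)
    odd-case (t , even , s≡tπ) = go (unit-basis g content)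
      where
      go : ∃[ β ] (¬ π ∣ fa (g ∘ᶠ S β)) → ∃[ β ] Descends ((s ·ᶠ g) ∘ᶠ S β)
      go (β , π∤a) = β , subst Descends (trans (cong (_·ᶠ (g ∘ᶠ S β)) (sym s≡tπ)) (sym (·ᶠ-∘ᶠ s g (S β)))) λ φ N eq →
        descent-odd φ t (g ∘ᶠ S β) (m₁₁ N) (m₁₂ N) (m₂₁ N) (m₂₂ N) even π∤a eq

-- Finite sums and bilinear forms

Σᶠ-cong : ∀ {n} {f g : Fin n → ℤ} → (∀ i → f i ≡ g i) → Σᶠ f ≡ Σᶠ g
Σᶠ-cong {zero}  eq = refl
Σᶠ-cong {suc n} eq = cong₂ _+_ (eq zero) (Σᶠ-cong (λ i → eq (suc i)))

Σᶠ-zero : ∀ n → Σᶠ {n} (λ _ → + 0) ≡ + 0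
Σᶠ-zero zero    = refl
Σᶠ-zero (suc n) = trans (+-identityˡ _) (Σᶠ-zero n)

Σᶠ-linear : ∀ {n} α β (f g : Fin n → ℤ) → Σᶠ (λ i → α * f i + β * g i) ≡ α * Σᶠ f + β * Σᶠ g
Σᶠ-linear {zero}  α β f g = ring α β
  where
  ring : ∀ α β → + 0 ≡ α * + 0 + β * + 0
  ring = solve-∀
Σᶠ-linear {suc n} α β f g = trans (cong (λ t → α * f zero + β * g zero + t) (Σᶠ-linear α β (λ i → f (suc i)) (λ i → g (suc i))))
  (ring α β (f zero) (g zero) (Σᶠ (λ i → f (suc i))) (Σᶠ (λ i → g (suc i))))
  where
  ring : ∀ α β f g F G → α * f + β * g + (α * F + β * G) ≡ α * (f + F) + β * (g + G)
  ring = solve-∀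

Σᶠ-+ : ∀ {n} (f g : Fin n → ℤ) → Σᶠ (λ i → f i + g i) ≡ Σᶠ f + Σᶠ g
Σᶠ-+ f g = begin
  Σᶠ (λ i → f i + g i)             ≡⟨ Σᶠ-cong (λ i → ring (f i) (g i)) ⟩
  Σᶠ (λ i → + 1 * f i + + 1 * g i) ≡⟨ Σᶠ-linear (+ 1) (+ 1) f g ⟩
  + 1 * Σᶠ f + + 1 * Σᶠ g          ≡⟨ ring (Σᶠ f) (Σᶠ g) ⟨
  Σᶠ f + Σᶠ g                      ∎
  where
  ring : ∀ i j → i + j ≡ + 1 * i + + 1 * j
  ring = solve-∀

Σᶠ-swap : ∀ {m n} (f : Fin m → Fin n → ℤ) → Σᶠ (λ i → Σᶠ (λ j → f i j)) ≡ Σᶠ (λ j → Σᶠ (λ i → f i j))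
Σᶠ-swap {zero}  {n} f = sym (Σᶠ-zero n)
Σᶠ-swap {suc m} f = trans (cong (λ t → Σᶠ (f zero) + t) (Σᶠ-swap (λ i → f (suc i))))
  (sym (Σᶠ-+ (f zero) (λ j → Σᶠ (λ i → f (suc i) j))))

comb : ∀ {n} → ℤ → Vect n → ℤ → Vect n → Vect n
comb α u β v i = α * u i + β * v i

dot : ∀ {n} → Vect n → Vect n → ℤ
dot c x = Σᶠ (λ i → c i * x i)

dot-cong : ∀ {n} (c : Vect n) {x y : Vect n} → (∀ i → x i ≡ y i) → dot c x ≡ dot c y
dot-cong c eq = Σᶠ-cong (λ i → cong (c i *_) (eq i))

dot-comb : ∀ {n} (c : Vect n) α u β v → dot c (comb α u β v) ≡ α * dot c u + β * dot c v
dot-comb c α u β v = trans (Σᶠ-cong (λ i → ring (c i) α (u i) β (v i)))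
  (Σᶠ-linear α β (λ i → c i * u i) (λ i → c i * v i))
  where
  ring : ∀ c α u β v → c * (α * u + β * v) ≡ α * (c * u) + β * (c * v)
  ring = solve-∀

dot-combˡ : ∀ {n} α (c : Vect n) β d x → dot (comb α c β d) x ≡ α * dot c x + β * dot d x
dot-combˡ α c β d x = trans (Σᶠ-cong (λ i → ring (x i) α (c i) β (d i)))
  (Σᶠ-linear α β (λ i → c i * x i) (λ i → d i * x i))
  where
  ring : ∀ x α c β d → (α * c + β * d) * x ≡ α * (c * x) + β * (d * x)
  ring = solve-∀

bil-cong : ∀ {n} (G : Mat n n) {x x′ y y′ : Vect n} → (∀ i → x i ≡ x′ i) → (∀ i → y i ≡ y′ i) → bil G x y ≡ bil G x′ y′
bil-cong G ex ey = Σᶠ-cong λ i → Σᶠ-cong λ j → cong₂ (λ a b → a * G i j * b) (ex i) (ey j)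

bil-combˡ : ∀ {n} (G : Mat n n) α u β v y → bil G (comb α u β v) y ≡ α * bil G u y + β * bil G v y
bil-combˡ G α u β v y = trans
  (Σᶠ-cong λ i → trans (Σᶠ-cong λ j → ring α (u i) β (v i) (G i j) (y j))
    (Σᶠ-linear α β (λ j → u i * G i j * y j) (λ j → v i * G i j * y j)))
  (Σᶠ-linear α β (λ i → Σᶠ (λ j → u i * G i j * y j)) (λ i → Σᶠ (λ j → v i * G i j * y j)))
  where
  ring : ∀ α u β v g y → (α * u + β * v) * g * y ≡ α * (u * g * y) + β * (v * g * y)
  ring = solve-∀

-- Representations of binary forms by lattices

module _ {n : ℕ} (L : IntLattice n) where

  B-sym : ∀ x y → B L x y ≡ B L y x
  B-sym x y = trans (Σᶠ-swap (λ i j → x i * gram L i j * y j))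
    (Σᶠ-cong λ j → Σᶠ-cong λ i → trans (cong (λ g → x i * g * y j) (symm L i j)) (ring (x i) (gram L j i) (y j)))
    where
    ring : ∀ x g y → x * g * y ≡ y * g * x
    ring = solve-∀

  B-comb : ∀ u v α β γ δ → B L (comb α u β v) (comb γ u δ v) ≡
    α * γ * Qf L u + (α * δ + β * γ) * B L u v + β * δ * Qf L v
  B-comb u v α β γ δ = begin
    B L (comb α u β v) y            ≡⟨ bil-combˡ (gram L) α u β v y ⟩
    α * B L u y + β * B L v y       ≡⟨ cong₂ (λ i j → α * i + β * j) (right u) (right v) ⟩
    α * (γ * B L u u + δ * B L v u) + β * (γ * B L u v + δ * B L v v)
      ≡⟨ cong (λ i → α * (γ * B L u u + δ * i) + β * (γ * B L u v + δ * B L v v)) (B-sym v u) ⟩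
    α * (γ * B L u u + δ * B L u v) + β * (γ * B L u v + δ * B L v v)
      ≡⟨ ring α β γ δ (B L u u) (B L u v) (B L v v) ⟩
    α * γ * Qf L u + (α * δ + β * γ) * B L u v + β * δ * Qf L v ∎
    where
    y : Vect n
    y = comb γ u δ v
    right : ∀ x → B L x y ≡ γ * B L u x + δ * B L v x
    right x = trans (B-sym x y) (bil-combˡ (gram L) γ u δ v x)
    ring : ∀ α β γ δ a b c → α * (γ * a + δ * b) + β * (γ * b + δ * c) ≡ α * γ * a + (α * δ + β * γ) * b + β * δ * c
    ring = solve-∀

  gramForm : Vect n → Vect n → BinForm
  gramForm u v = form (Qf L u) (+ 2 * B L u v) (Qf L v)

  gramForm-cong : ∀ {u u′ v v′} → (∀ i → u i ≡ u′ i) → (∀ i → v i ≡ v′ i) → gramForm u v ≡ gramForm u′ v′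
  gramForm-cong eu ev = form-≡ (bil-cong (gram L) eu eu) (cong (+ 2 *_) (bil-cong (gram L) eu ev)) (bil-cong (gram L) ev ev)

  gramForm-comb : ∀ u v α β γ δ → gramForm (comb α u γ v) (comb β u δ v) ≡ gramForm u v ∘ᶠ mat α β γ δ
  gramForm-comb u v α β γ δ = form-≡
    (trans (B-comb u v α γ α γ) (r₁ (Qf L u) (B L u v) (Qf L v) α γ))
    (trans (cong (+ 2 *_) (B-comb u v α γ β δ)) (r₂ (Qf L u) (B L u v) (Qf L v) α β γ δ))
    (trans (B-comb u v β δ β δ) (r₁ (Qf L u) (B L u v) (Qf L v) β δ))
    where
    r₁ : ∀ a b c α γ → α * α * a + (α * γ + γ * α) * b + γ * γ * c ≡ a * α * α + + 2 * b * α * γ + c * γ * γ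
    r₁ = solve-∀
    r₂ : ∀ a b c α β γ δ → + 2 * (α * β * a + (α * δ + γ * β) * b + γ * δ * c)
      ≡ + 2 * a * α * β + + 2 * b * (α * δ + β * γ) + + 2 * c * γ * δ
    r₂ = solve-∀

  Q-comb : ∀ u v x y → Qf L (comb x u y v) ≡ evalF (gramForm u v) x y
  -- Only the first column of the matrix enters the leading coefficient, so the second is set to
  -- zero.
  Q-comb u v x y = cong fa (gramForm-comb u v x (+ 0) y (+ 0))

  -- A representation recorded by the images of the two basis vectors, so that base changes act
  -- through `∘ᶠ`.
  Rep : BinForm → Set
  Rep f = ∃[ u ] ∃[ v ] (gramForm u v ≡ f)

  rep-∘ : ∀ {f} M → Rep f → Rep (f ∘ᶠ M)
  rep-∘ (mat α β γ δ) (u , v , eq) =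
    comb α u γ v , comb β u δ v , trans (gramForm-comb u v α β γ δ) (cong (_∘ᶠ mat α β γ δ) eq)

columns : ∀ {n} → Vect n → Vect n → Mat n 2
columns u v i zero       = u i
columns u v i (suc zero) = v i

columns-·ᵥ : ∀ {n} (u v : Vect n) y i → (columns u v ·ᵥ y) i ≡ comb (y zero) u (y (suc zero)) v i
columns-·ᵥ u v y i = ring (u i) (v i) (y zero) (y (suc zero))
  where
  ring : ∀ u v x y → u * x + (v * y + + 0) ≡ x * u + y * v
  ring = solve-∀

toMat : Mat₂ → Mat 2 2
toMat M zero       zero       = m₁₁ M
toMat M zero       (suc zero) = m₁₂ M
toMat M (suc zero) zero       = m₂₁ M
toMat M (suc zero) (suc zero) = m₂₂ M

twoBℓ-expand : ∀ f x y → twoBℓ f x y ≡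
  + 2 * fa f * x zero * y zero + fb f * (x zero * y (suc zero) + x (suc zero) * y zero) + + 2 * fc f * x (suc zero) * y (suc zero)
twoBℓ-expand f x y = ring (fa f) (fb f) (fc f) (x zero) (x (suc zero)) (y zero) (y (suc zero))
  where
  ring : ∀ a b c x₀ x₁ y₀ y₁ → x₀ * (+ 2 * a) * y₀ + (x₀ * b * y₁ + + 0) + (x₁ * b * y₀ + (x₁ * (+ 2 * c) * y₁ + + 0) + + 0)
    ≡ + 2 * a * x₀ * y₀ + b * (x₀ * y₁ + x₁ * y₀) + + 2 * c * x₁ * y₁
  ring = solve-∀

e₁ e₂ : Vect 2
e₁ zero       = + 1
e₁ (suc zero) = + 0
e₂ zero       = + 0
e₂ (suc zero) = + 1

module _ {n : ℕ} (L : IntLattice n) where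

  represents : ∀ f → Rep L f → Represents L f
  represents f (u , v , refl) = columns u v , λ y z → begin
    + 2 * B L (columns u v ·ᵥ y) (columns u v ·ᵥ z)
      ≡⟨ cong (+ 2 *_) (bil-cong (gram L) (columns-·ᵥ u v y) (columns-·ᵥ u v z)) ⟩
    + 2 * B L (comb (y zero) u (y (suc zero)) v) (comb (z zero) u (z (suc zero)) v)
      ≡⟨ cong (+ 2 *_) (B-comb L u v (y zero) (y (suc zero)) (z zero) (z (suc zero))) ⟩
    _ ≡⟨ ring (Qf L u) (B L u v) (Qf L v) (y zero) (y (suc zero)) (z zero) (z (suc zero)) ⟩
    _ ≡⟨ twoBℓ-expand (gramForm L u v) y z ⟨
    twoBℓ (gramForm L u v) y z ∎
    where
    ring : ∀ a b c y₀ y₁ z₀ z₁ → + 2 * (y₀ * z₀ * a + (y₀ * z₁ + y₁ * z₀) * b + y₁ * z₁ * c)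
      ≡ + 2 * a * y₀ * z₀ + + 2 * b * (y₀ * z₁ + y₁ * z₀) + + 2 * c * y₁ * z₁
    ring = solve-∀

  rep-sublattice : ∀ f M → RepresentsSub L f (toMat M) → Rep L (f ∘ᶠ M)
  -- The isometry is tested on three pairs of basis vectors. The factor 2 is cancelled on the
  -- diagonal, whereas the middle coefficient of `gramForm` contains it.
  rep-sublattice f@(form a b c) M@(mat α β γ δ) (T , isometry) = T ·ᵥ e₁ , T ·ᵥ e₂ , form-≡
    (*-cancelˡ (+ 2) (λ ()) (trans (trans (isometry e₁ e₁) (twoBℓ-expand f (toMat M ·ᵥ e₁) (toMat M ·ᵥ e₁))) (r₁ a b c α β γ δ)))
    (trans (trans (isometry e₁ e₂) (twoBℓ-expand f (toMat M ·ᵥ e₁) (toMat M ·ᵥ e₂))) (r₂ a b c α β γ δ))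
    (*-cancelˡ (+ 2) (λ ()) (trans (trans (isometry e₂ e₂) (twoBℓ-expand f (toMat M ·ᵥ e₂) (toMat M ·ᵥ e₂))) (r₃ a b c α β γ δ)))
    where
    r₁ : ∀ a b c α β γ δ →
      + 2 * a * (α * + 1 + (β * + 0 + + 0)) * (α * + 1 + (β * + 0 + + 0))
      + b * ((α * + 1 + (β * + 0 + + 0)) * (γ * + 1 + (δ * + 0 + + 0)) + (γ * + 1 + (δ * + 0 + + 0)) * (α * + 1 + (β * + 0 + + 0)))
      + + 2 * c * (γ * + 1 + (δ * + 0 + + 0)) * (γ * + 1 + (δ * + 0 + + 0))
      ≡ + 2 * (a * α * α + b * α * γ + c * γ * γ)
    r₁ = solve-∀
    r₂ : ∀ a b c α β γ δ →
      + 2 * a * (α * + 1 + (β * + 0 + + 0)) * (α * + 0 + (β * + 1 + + 0))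
      + b * ((α * + 1 + (β * + 0 + + 0)) * (γ * + 0 + (δ * + 1 + + 0)) + (γ * + 1 + (δ * + 0 + + 0)) * (α * + 0 + (β * + 1 + + 0)))
      + + 2 * c * (γ * + 1 + (δ * + 0 + + 0)) * (γ * + 0 + (δ * + 1 + + 0))
      ≡ + 2 * a * α * β + b * (α * δ + β * γ) + + 2 * c * γ * δ
    r₂ = solve-∀
    r₃ : ∀ a b c α β γ δ →
      + 2 * a * (α * + 0 + (β * + 1 + + 0)) * (α * + 0 + (β * + 1 + + 0))
      + b * ((α * + 0 + (β * + 1 + + 0)) * (γ * + 0 + (δ * + 1 + + 0)) + (γ * + 0 + (δ * + 1 + + 0)) * (α * + 0 + (β * + 1 + + 0)))
      + + 2 * c * (γ * + 0 + (δ * + 1 + + 0)) * (γ * + 0 + (δ * + 1 + + 0))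
      ≡ + 2 * (a * β * β + b * β * δ + c * δ * δ)
    r₃ = solve-∀

-- Saturation of binary sublattices

-- The vector `c` certifies that `x′` has coprime entries. By induction, the content of the tail is
-- merged with the head through a Bézout identity, whose coefficients extend `c`.
primitive-part : ∀ {n} (x : Vect n) →
  (∀ i → x i ≡ + 0) ⊎ ∃[ k ] ∃[ x′ ] ∃[ c ] (k ≢ + 0 × (∀ i → x i ≡ k * x′ i) × dot c x′ ≡ + 1)
primitive-part {zero}  x = inj₁ λ ()
primitive-part {suc n} x with primitive-part (λ i → x (suc i))
... | inj₁ tail≡0 with x zero ≟ + 0
...   | yes head≡0 = inj₁ λ { zero → head≡0 ; (suc i) → tail≡0 i }
...   | no  head≢0 = inj₂ (x zero , x′ , x′ , head≢0 ,
          (λ { zero → sym (*-identityʳ (x zero)) ; (suc i) → trans (tail≡0 i) (sym (*-zeroʳ (x zero))) }) ,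
          cong (λ t → + 1 + t) (Σᶠ-zero n))
  where
  x′ : Vect (suc n)
  x′ zero    = + 1
  x′ (suc _) = + 0
primitive-part {suc n} x | inj₂ (k , y , c , k≢0 , tail , c·y≡1) with bézout (x zero) k
...   | d , a′ , k′ , α , β , ea , ek , combination = inj₂ (d , x′ , c′ , d≢0 , multiple , normalised)
  where
  x′ c′ : Vect (suc n)
  x′ zero    = a′
  x′ (suc i) = k′ * y i
  c′ zero    = α
  c′ (suc i) = β * c i
  d≢0 : d ≢ + 0
  d≢0 d≡0 = k≢0 (trans ek (trans (cong (k′ *_) d≡0) (*-zeroʳ k′)))
  multiple : ∀ i → x i ≡ d * x′ i
  multiple zero    = trans ea (*-comm a′ d)
  multiple (suc i) = trans (tail i) (trans (cong (_* y i) ek) (ring k′ d (y i)))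
    where
    ring : ∀ k d y → k * d * y ≡ d * (k * y)
    ring = solve-∀
  tail-sum : Σᶠ (λ i → β * c i * (k′ * y i)) ≡ β * k′
  tail-sum = begin
    Σᶠ (λ i → β * c i * (k′ * y i))                     ≡⟨ Σᶠ-cong (λ i → ring₁ β (c i) k′ (y i)) ⟩
    Σᶠ (λ i → β * k′ * (c i * y i) + + 0 * (c i * y i)) ≡⟨ Σᶠ-linear (β * k′) (+ 0) (λ i → c i * y i) (λ i → c i * y i) ⟩
    β * k′ * dot c y + + 0 * dot c y                    ≡⟨ cong (λ t → β * k′ * t + + 0 * t) c·y≡1 ⟩
    β * k′ * + 1 + + 0 * + 1                            ≡⟨ ring₂ (β * k′) ⟩
    β * k′ ∎
    where
    ring₁ : ∀ β c k y → β * c * (k * y) ≡ β * k * (c * y) + + 0 * (c * y)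
    ring₁ = solve-∀
    ring₂ : ∀ t → t * + 1 + + 0 * + 1 ≡ t
    ring₂ = solve-∀
  normalised : α * a′ + Σᶠ (λ i → β * c i * (k′ * y i)) ≡ + 1
  normalised = *-cancelˡ d d≢0 (begin
    d * (α * a′ + Σᶠ (λ i → β * c i * (k′ * y i))) ≡⟨ cong (λ t → d * (α * a′ + t)) tail-sum ⟩
    d * (α * a′ + β * k′)                          ≡⟨ ring d α a′ β k′ ⟩
    α * (a′ * d) + β * (k′ * d)                    ≡⟨ cong₂ (λ i j → α * i + β * j) ea ek ⟨
    α * x zero + β * k                             ≡⟨ combination ⟩
    d                                              ≡⟨ *-identityʳ d ⟨
    d * + 1                                        ∎)
    where
    ring : ∀ d α a β k → d * (α * a + β * k) ≡ α * (a * d) + β * (k * d)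
    ring = solve-∀

dot-multiple : ∀ {n} (e : Vect n) k x → dot e (λ i → k * x i) ≡ k * dot e x
dot-multiple e k x = begin
  dot e (λ i → k * x i)          ≡⟨ dot-cong e (λ i → ring (k * x i) (x i)) ⟩
  dot e (comb k x (+ 0) x)       ≡⟨ dot-comb e k x (+ 0) x ⟩
  k * dot e x + + 0 * dot e x    ≡⟨ ring (k * dot e x) (dot e x) ⟨
  k * dot e x                    ∎
  where
  ring : ∀ i j → i ≡ i + + 0 * j
  ring = solve-∀

-- An integral left inverse of the matrix with columns u, v.
record Dual {n : ℕ} (u v : Vect n) : Set where
  field
    c d : Vect n
    c·u : dot c u ≡ + 1
    c·v : dot c v ≡ + 0
    d·u : dot d u ≡ + 0
    d·v : dot d v ≡ + 1

module _ {n : ℕ} {u v : Vect n} (dual : Dual u v) where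
  open Dual dual

  private
    dot-columns : ∀ e y → dot e (columns u v ·ᵥ y) ≡ y zero * dot e u + y (suc zero) * dot e v
    dot-columns e y = trans (dot-cong e (columns-·ᵥ u v y)) (dot-comb e (y zero) u (y (suc zero)) v)

    coordinate₁ : ∀ y → dot c (columns u v ·ᵥ y) ≡ y zero
    coordinate₁ y = trans (dot-columns c y) (trans (cong₂ (λ i j → y zero * i + y (suc zero) * j) c·u c·v) (ring (y zero) (y (suc zero))))
      where
      ring : ∀ i j → i * + 1 + j * + 0 ≡ i
      ring = solve-∀

    coordinate₂ : ∀ y → dot d (columns u v ·ᵥ y) ≡ y (suc zero)
    coordinate₂ y = trans (dot-columns d y) (trans (cong₂ (λ i j → y zero * i + y (suc zero) * j) d·u d·v) (ring (y zero) (y (suc zero))))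
      where
      ring : ∀ i j → i * + 0 + j * + 1 ≡ j
      ring = solve-∀

  dual⇒rank2 : Rank2 (columns u v)
  dual⇒rank2 y Ty≡0 = λ { zero → trans (sym (coordinate₁ y)) (vanish c) ; (suc zero) → trans (sym (coordinate₂ y)) (vanish d) }
    where
    vanish : ∀ e → dot e (columns u v ·ᵥ y) ≡ + 0
    vanish e = trans (Σᶠ-cong λ i → trans (cong (e i *_) (Ty≡0 i)) (*-zeroʳ (e i))) (Σᶠ-zero n)

  -- Applying the dual vectors to k x = T y shows that k divides y, with quotient (c·x, d·x).
  dual⇒primitive : Primitive (columns u v)
  dual⇒primitive x k k≢0 (y , kx≡Ty) = z , λ i → *-cancelˡ k k≢0 (begin
    k * x i                                      ≡⟨ kx≡Ty i ⟩
    u i * y zero + (v i * y (suc zero) + + 0)    ≡⟨ cong₂ (λ s t → u i * s + (v i * t + + 0)) y₀ y₁ ⟩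
    u i * (k * dot c x) + (v i * (k * dot d x) + + 0) ≡⟨ ring (u i) (v i) k (dot c x) (dot d x) ⟩
    k * (u i * dot c x + (v i * dot d x + + 0))  ∎)
    where
    z : Vect 2
    z zero       = dot c x
    z (suc zero) = dot d x
    y₀ : y zero ≡ k * dot c x
    y₀ = trans (sym (coordinate₁ y)) (trans (sym (dot-cong c kx≡Ty)) (dot-multiple c k x))
    y₁ : y (suc zero) ≡ k * dot d x
    y₁ = trans (sym (coordinate₂ y)) (trans (sym (dot-cong d kx≡Ty)) (dot-multiple d k x))
    ring : ∀ u v k s t → u * (k * s) + (v * (k * t) + + 0) ≡ k * (u * s + (v * t + + 0))
    ring = solve-∀

module _ {n : ℕ} (L : IntLattice n) where

  private
    -- The Gram form factors through a matrix of determinant zero. This excludes dependent vectors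
    -- in `saturate`.
    parallel : ∀ w {u v : Vect n} α β → (∀ i → u i ≡ α * w i) → (∀ i → v i ≡ β * w i) → discF (gramForm L u v) ≡ + 0
    parallel w {u} {v} α β eu ev = begin
      discF (gramForm L u v)
        ≡⟨ cong discF (gramForm-cong L (λ i → trans (eu i) (pad (α * w i) (w i))) (λ i → trans (ev i) (pad (β * w i) (w i)))) ⟩
      discF (gramForm L (comb α w (+ 0) w) (comb β w (+ 0) w)) ≡⟨ cong discF (gramForm-comb L w w α β (+ 0) (+ 0)) ⟩
      discF (gramForm L w w ∘ᶠ mat α β (+ 0) (+ 0)) ≡⟨ discF-∘ (gramForm L w w) (mat α β (+ 0) (+ 0)) ⟩
      (α * + 0 - β * + 0) * (α * + 0 - β * + 0) * discF (gramForm L w w) ≡⟨ vanish α β (discF (gramForm L w w)) ⟩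
      + 0 ∎
      where
      pad : ∀ i j → i ≡ i + + 0 * j
      pad = solve-∀
      vanish : ∀ α β D → (α * + 0 - β * + 0) * (α * + 0 - β * + 0) * D ≡ + 0
      vanish = solve-∀

  -- Integral Gram-Schmidt: u = k u′ with c·u′ = 1, then the remainder r = v - (c·v) u′ lies in the
  -- kernel of c and has a primitive part v′. Hence N is upper triangular, with diagonal entries k
  -- and l.
  saturate : ∀ u v → discF (gramForm L u v) ≢ + 0 →
    ∃[ u′ ] ∃[ v′ ] ∃[ N ] (Dual u′ v′ × gramForm L u′ v′ ∘ᶠ N ≡ gramForm L u v)
  saturate u v disc≢0 = first (primitive-part u)
    where
    Goal : Set
    Goal = ∃[ u′ ] ∃[ v′ ] ∃[ N ] (Dual u′ v′ × gramForm L u′ v′ ∘ᶠ N ≡ gramForm L u v)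
    first : (∀ i → u i ≡ + 0) ⊎ ∃[ k ] ∃[ u′ ] ∃[ c ] (k ≢ + 0 × (∀ i → u i ≡ k * u′ i) × dot c u′ ≡ + 1) → Goal
    first (inj₁ u≡0) = ⊥-elim (disc≢0 (parallel v (+ 0) (+ 1) u≡0 (λ i → sym (*-identityˡ (v i)))))
    first (inj₂ (k , u′ , c , k≢0 , u≡ku′ , c·u′)) = second (primitive-part r)
      where
      λ₀ : ℤ
      λ₀ = dot c v
      r : Vect n
      r = comb (+ 1) v (- λ₀) u′
      second : (∀ i → r i ≡ + 0) ⊎ ∃[ l ] ∃[ v′ ] ∃[ d ] (l ≢ + 0 × (∀ i → r i ≡ l * v′ i) × dot d v′ ≡ + 1) → Goal
      second (inj₁ r≡0) = ⊥-elim (disc≢0 (parallel u′ k λ₀ u≡ku′ λ i → ≡-comb₁ (+ 1) (r≡0 i) (ring (v i) λ₀ (u′ i))))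
        where
        ring : ∀ v l u → v - l * u ≡ + 1 * (+ 1 * v + - l * u - + 0)
        ring = solve-∀
      second (inj₂ (l , v′ , d , l≢0 , r≡lv′ , d·v′)) =
        u′ , v′ , mat k λ₀ (+ 0) l , dual ,
        trans (sym (gramForm-comb L u′ v′ k λ₀ (+ 0) l)) (gramForm-cong L
          (λ i → trans (pad (k * u′ i) (v′ i)) (sym (u≡ku′ i)))
          (λ i → ≡-comb₁ (- + 1) (r≡lv′ i) (ring (v i) λ₀ (u′ i) l (v′ i))))
        where
        pad : ∀ i j → i + + 0 * j ≡ i
        pad = solve-∀
        ring : ∀ v k u l w → k * u + l * w - v ≡ - + 1 * (+ 1 * v + - k * u - l * w)
        ring = solve-∀
        c·v′ : dot c v′ ≡ + 0
        c·v′ = *-≡0⇒ʳ l l≢0 (begin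
          l * dot c v′                  ≡⟨ dot-multiple c l v′ ⟨
          dot c (λ i → l * v′ i)        ≡⟨ dot-cong c r≡lv′ ⟨
          dot c r                       ≡⟨ dot-comb c (+ 1) v (- λ₀) u′ ⟩
          + 1 * dot c v + - λ₀ * dot c u′ ≡⟨ cong (λ t → + 1 * λ₀ + - λ₀ * t) c·u′ ⟩
          + 1 * λ₀ + - λ₀ * + 1         ≡⟨ cancel λ₀ ⟩
          + 0 ∎)
          where
          cancel : ∀ i → + 1 * i + - i * + 1 ≡ + 0
          cancel = solve-∀
        d₀ : ℤ
        d₀ = dot d u′
        dual : Dual u′ v′
        dual = record
          -- Subtracting (d·u′) c makes the second functional kill u′ and keeps its value at v′,
          -- since c·v′ = 0.
          { c = c ; d = comb (+ 1) d (- d₀) c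
          ; c·u = c·u′ ; c·v = c·v′
          ; d·u = trans (dot-combˡ (+ 1) d (- d₀) c u′) (trans (cong (λ t → + 1 * d₀ + - d₀ * t) c·u′) (cancel d₀))
          ; d·v = trans (dot-combˡ (+ 1) d (- d₀) c v′) (trans (cong₂ (λ s t → + 1 * s + - d₀ * t) d·v′ c·v′) (one d₀))
          }
          where
          cancel : ∀ i → + 1 * i + - i * + 1 ≡ + 0
          cancel = solve-∀
          one : ∀ i → + 1 * + 1 + - i * + 0 ≡ + 1
          one = solve-∀

-- Divisibility of the saturated image

module _ {p : ℕ} (pr : Prime p) where
  open PrimeDivisor pr
  open Descent pr
  open BaseChange pr

  -- Every value of a binary form is an integral combination of its values at (1,0), (0,1) and
  -- (1,1), so three tests decide.
  divisible? : ∀ φ → (∀ x y → π ∣ evalF φ x y) ⊎ ∃[ x ] ∃[ y ] (¬ π ∣ evalF φ x y)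
  divisible? φ@(form a b c) with π ∣? evalF φ (+ 1) (+ 0) | π ∣? evalF φ (+ 0) (+ 1) | π ∣? evalF φ (+ 1) (+ 1)
  ... | no ¬h   | _       | _       = inj₂ (+ 1 , + 0 , ¬h)
  ... | yes _   | no ¬h   | _       = inj₂ (+ 0 , + 1 , ¬h)
  ... | yes _   | yes _   | no ¬h   = inj₂ (+ 1 , + 1 , ¬h)
  ... | yes h₁  | yes h₂  | yes h₃  = inj₁ λ x y →
        ∣-comb₃ (x * x - x * y) (y * y - x * y) (x * y) h₁ h₂ h₃ (ring a b c x y)
    where
    ring : ∀ a b c x y → a * x * x + b * x * y + c * y * y ≡
      (x * x - x * y) * (a * + 1 * + 1 + b * + 1 * + 0 + c * + 0 * + 0)
      + (y * y - x * y) * (a * + 0 * + 0 + b * + 0 * + 1 + c * + 1 * + 1)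
      + x * y * (a * + 1 * + 1 + b * + 1 * + 1 + c * + 1 * + 1)
    ring = solve-∀

  -- M is the saturation of the image of the sublattice. A value of its form prime to `π` would let
  -- the representation descend to `f` itself.
  divisible-sublattice : ∀ {n} (L : IntLattice n) f → discF (f ∘ᶠ U) ≢ + 0 → Descends f →
    Rep L (f ∘ᶠ U) → ¬ Rep L f → ∃[ T ] (Rank2 {n} T × Primitive T × NormDividedBy L T π)
  divisible-sublattice {n} L f disc≢0 descends (u , v , gram≡) ¬rep =
    go (saturate L u v (λ e → disc≢0 (trans (cong discF (sym gram≡)) e)))
    where
    go : ∃[ u′ ] ∃[ v′ ] ∃[ N ] (Dual u′ v′ × gramForm L u′ v′ ∘ᶠ N ≡ gramForm L u v) →
      ∃[ T ] (Rank2 {n} T × Primitive T × NormDividedBy L T π)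
    go (u′ , v′ , N , dual , eq) =
      columns u′ v′ , dual⇒rank2 dual , dual⇒primitive dual , λ y → ∣⇒∣ᵤ (subst (π ∣_)
        (sym (trans (bil-cong (gram L) (columns-·ᵥ u′ v′ y) (columns-·ᵥ u′ v′ y)) (Q-comb L u′ v′ (y zero) (y (suc zero)))))
        ([ (λ h → h (y zero) (y (suc zero))) , (λ h → ⊥-elim (impossible h)) ]′ (divisible? φ)))
      where
      φ : BinForm
      φ = gramForm L u′ v′
      impossible : ¬ (∃[ x ] ∃[ y ] (¬ π ∣ evalF φ x y))
      impossible (x , y , π∤φ) with descends φ N (trans eq gram≡) x y π∤φ
      ... | N′ , φ∘N′≡f = ¬rep (subst (Rep L) φ∘N′≡f (rep-∘ L N′ (u′ , v′ , refl)))

  kronecker⇒∤ : ∀ D → KroneckerOne D p → ¬ π ∣ D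
  kronecker⇒∤ D (inj₂ (_ , p∤D , _)) π∣D = p∤D (∣⇒∣ᵤ π∣D)
  -- For p = 2, a D congruent to 1 or -1 modulo 8 is odd.
  kronecker⇒∤ D (inj₁ (refl , inj₁ h)) π∣D =
    π∤1 (∣-comb₂ (+ 1) (- + 1) π∣D (∣-trans (divides {+ 2} {+ 8} (+ 4) refl) (∣ᵤ⇒∣ {+ 8} {D - + 1} h)) (ring D))
    where
    ring : ∀ D → + 1 ≡ + 1 * D + - + 1 * (D - + 1)
    ring = solve-∀
  kronecker⇒∤ D (inj₁ (refl , inj₂ h)) π∣D =
    π∤1 (∣-comb₂ (- + 1) (+ 1) π∣D (∣-trans (divides {+ 2} {+ 8} (+ 4) refl) (∣ᵤ⇒∣ {+ 8} {D - - + 1} h)) (ring D))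
    where
    ring : ∀ D → + 1 ≡ - + 1 * D + + 1 * (D - - + 1)
    ring = solve-∀

-- Norm, content and conclusion

∣-LinComb : ∀ m f → (∀ v → m ∣ Qℓ f v) → ∀ cs → m ∣ LinComb f cs
∣-LinComb m f h []             = divides (+ 0) refl
∣-LinComb m f h ((k , v) ∷ cs) = ∣m∣n⇒∣m+n (∣n⇒∣m*n k (h v)) (∣-LinComb m f h cs)

-- The outer coefficients are values of the form, and b = Q(1,1) - a - c.
norm-factor : ∀ f s → (∀ v → s ℤᵘ.∣ Qℓ f v) → ∃[ g ] (f ≡ s ·ᶠ g)
norm-factor (form a b c) s h = form (quotient s∣a) (quotient s∣b) (quotient s∣c) ,
  form-≡ (trans (_∣_.equality s∣a) (*-comm (quotient s∣a) s)) (trans (_∣_.equality s∣b) (*-comm (quotient s∣b) s))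
         (trans (_∣_.equality s∣c) (*-comm (quotient s∣c) s))
  where
  e₃ : Vect 2
  e₃ _ = + 1
  s∣a : s ∣ a
  s∣a = ∣-comb₁ (+ 1) (∣ᵤ⇒∣ {s} {Qℓ (form a b c) e₁} (h e₁)) (ring a b c)
    where
    ring : ∀ a b c → a ≡ + 1 * (a * + 1 * + 1 + b * + 1 * + 0 + c * + 0 * + 0)
    ring = solve-∀
  s∣c : s ∣ c
  s∣c = ∣-comb₁ (+ 1) (∣ᵤ⇒∣ {s} {Qℓ (form a b c) e₂} (h e₂)) (ring a b c)
    where
    ring : ∀ a b c → c ≡ + 1 * (a * + 0 * + 0 + b * + 0 * + 1 + c * + 1 * + 1)
    ring = solve-∀
  s∣b : s ∣ b
  s∣b = ∣-comb₃ (+ 1) (- + 1) (- + 1) (∣ᵤ⇒∣ {s} {Qℓ (form a b c) e₃} (h e₃)) s∣a s∣c (ring a b c)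
    where
    ring : ∀ a b c → b ≡ + 1 * (a * + 1 * + 1 + b * + 1 * + 1 + c * + 1 * + 1) + - + 1 * a + - + 1 * c
    ring = solve-∀

theorem3p4 : (ℓ : BinForm) (s D : ℤ) (n : ℕ) (L : IntLattice n) →
    PosDefLattice ℓ → + 0 < s → NormIs ℓ s → discF ℓ ≡ s * s * D →
    Irrecoverable ℓ → IsIsolation ℓ L →
    (p : ℕ) → Prime p → KroneckerOne D p → RepresentedByAmbiguous D (+ p) →
    ∃[ T ] (Rank2 {n} T × Primitive T × NormDividedBy L T (+ p))
theorem3p4 ℓ s D n L _ 0<s (s∣Q , cs , combination) disc-ℓ _ (sublattices , ¬represents) p pr kronecker ambiguous =
  factored (norm-factor ℓ s s∣Q)
  where
  open PrimeDivisor pr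
  open Descent pr using (U; π²≢0)
  open BaseChange pr
  open Basis
  s≢0 : s ≢ + 0
  s≢0 s≡0 = <-irrefl (sym s≡0) 0<s
  s²≢0 : s * s ≢ + 0
  s²≢0 = *-≢0 s s s≢0 s≢0
  π∤D : ¬ π ∣ D
  π∤D = kronecker⇒∤ pr D kronecker
  D≢0 : D ≢ + 0
  D≢0 D≡0 = π∤D (divides (+ 0) D≡0)
  Goal : Set
  Goal = ∃[ T ] (Rank2 {n} T × Primitive T × NormDividedBy L T (+ p))
  finish : ∃[ β ] Descends (ℓ ∘ᶠ S β) → Goal
  -- The sublattice spanned by the columns of S U has index `π` > 1, so L represents it. A
  -- representation of the form in the new basis is brought back to `ℓ` by `S⁻¹`.
  finish (β , descends) = divisible-sublattice pr L (ℓ ∘ᶠ S β) disc≢0 descends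
    (subst (Rep L) (sym (∘ᶠ-∙ ℓ (S β) U)) (rep-sublattice L ℓ (S β ∙ U)
      (sublattices (toMat (S β ∙ U)) (subst (λ d → + 1 < + abs d) (sym det≡π) (+<+ 1<p)))))
    (λ rep → ¬represents (represents L ℓ (subst (Rep L) identity (rep-∘ L (S⁻¹ β) rep))))
    where
    det≡π : det (S β ∙ U) ≡ π
    det≡π = trans (ring (m₁₁ (S β)) (m₁₂ (S β)) (m₂₁ (S β)) (m₂₂ (S β)) π)
      (trans (cong (_* π) (det≡1 β)) (*-identityˡ π))
      where
      ring : ∀ a b c d π → (a * + 1 + b * + 0) * (c * + 0 + d * π) - (a * + 0 + b * π) * (c * + 1 + d * + 0) ≡ (a * d - b * c) * π
      ring = solve-∀
    disc≢0 : discF (ℓ ∘ᶠ S β ∘ᶠ U) ≢ + 0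
    disc≢0 e = *-≢0 (π * π) (s * s * D) π²≢0 (*-≢0 (s * s) D s²≢0 D≢0) (begin
      π * π * (s * s * D)                                ≡⟨ cong₂ (λ d Δ → d * d * Δ) det≡π disc-ℓ ⟨
      det (S β ∙ U) * det (S β ∙ U) * discF ℓ            ≡⟨ discF-∘ ℓ (S β ∙ U) ⟨
      discF (ℓ ∘ᶠ (S β ∙ U))                             ≡⟨ cong discF (∘ᶠ-∙ ℓ (S β) U) ⟨
      discF (ℓ ∘ᶠ S β ∘ᶠ U)                              ≡⟨ e ⟩
      + 0                                                ∎)
    identity : ℓ ∘ᶠ S β ∘ᶠ S⁻¹ β ≡ ℓ
    identity = trans (∘ᶠ-∙ ℓ (S β) (S⁻¹ β)) (trans (cong (ℓ ∘ᶠ_) (inverse β)) (trans (∘ᶠ-scalar ℓ (+ 1))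
      (form-≡ (*-identityˡ (fa ℓ)) (*-identityˡ (fb ℓ)) (*-identityˡ (fc ℓ)))))
  factored : ∃[ g ] (ℓ ≡ s ·ᶠ g) → Goal
  factored (g@(form a b c) , ℓ≡sg) = finish (subst (λ f → ∃[ β ] Descends (f ∘ᶠ S β)) (sym ℓ≡sg)
    (descending-basis s g D s≢0 disc-g π∤D ambiguous content))
    where
    disc-g : discF g ≡ D
    disc-g = *-cancelˡ (s * s) s²≢0 (trans (sym (discF-· s g)) (trans (cong discF (sym ℓ≡sg)) disc-ℓ))
    content : ¬ (π ∣ a × π ∣ b × π ∣ c)
    -- Otherwise all values of `ℓ` would be divisible by s π, and hence so would their combination
    -- s.
    content (π∣a , π∣b , π∣c) = unit-multiple (∣-LinComb (s * π) ℓ divisible cs)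
      where
      divisible : ∀ v → s * π ∣ Qℓ ℓ v
      divisible v = subst (s * π ∣_) (sym (trans (cong (λ f → Qℓ f v) ℓ≡sg) (evalF-· s g (v zero) (v (suc zero)))))
        (*-monoʳ-∣ s (∣-comb₃ (v zero * v zero) (v zero * v (suc zero)) (v (suc zero) * v (suc zero)) π∣a π∣b π∣c
          (ring a b c (v zero) (v (suc zero)))))
        where
        ring : ∀ a b c x y → a * x * x + b * x * y + c * y * y ≡ x * x * a + x * y * b + y * y * c
        ring = solve-∀
      unit-multiple : ¬ s * π ∣ LinComb ℓ cs
      unit-multiple (divides q eq) = π∤1 (divides q (*-cancelˡ s s≢0 (begin
        s * + 1         ≡⟨ *-identityʳ s ⟩
        s               ≡⟨ combination ⟨
        LinComb ℓ cs    ≡⟨ eq ⟩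
        q * (s * π)     ≡⟨ ring q s π ⟩
        s * (q * π)     ∎)))
        where
        ring : ∀ q s π → q * (s * π) ≡ s * (q * π)
        ring = solve-∀
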